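{- Let $r,d$ be positive integers and let $s\geq (r-1)(d+1)+2$. Suppose that there exist $a_0, n_0$ such that for all $a\geq a_0$ and $n\geq n_0$ we have \[\mathrm{ex}_{\Pi}(n, s, \Sigma_{r,d}(a,s)) = \Pi_{r,d}(a,n).\] Then there exist $a_1\geq a_0$ and $n_1\geq n_0$ such that for all $a\geq a_1$ and $n\geq n_1$, we have \[\mathrm{ex}_{\Pi}(n, s+1, \Sigma_{r,d}(a,s+1)) = \Pi_{r,d}(a,n).\]
   Context: A multigraph is a pair $G=(V,w)$ where $V$ is a finite set and $w:\binom{V}{2}\to\mathbb{Z}_{\geq 0}$. For $X\subseteq V$ write $e(G[X])=\sum_{xy\in\binom{X}{2}}w(xy)$, $e(G)=e(G[V])$ and $P(G)=\prod_{xy\in\binom{V}{2}}w(xy)$. Given integers $s\geq 2$, $q\geq 0$, $\mathcal{F}(n,s,q)$ denotes the set of multigraphs on vertex set $[n]=\{1,\dots,n\}$ in which every $s$-set $X$ of vertices satisfies $e(G[X])\leq q$, and $\mathrm{ex}_{\Pi}(n,s,q)=\max\{P(G): G\in\mathcal{F}(n,s,q)\}$. For positive integers $a,r$, $d\in\{0,\dots,a-1\}$ and $n$, $\mathcal{T}_{r,d}(a,n)$ is the set of multigraphs $G$ on $[n]$ whose vertex set can be partitioned into $r$ parts $V_0,\dots,V_{r-1}$ such that all pairs inside $V_0$ have multiplicity $a-d$, all pairs inside $V_i$ ($1\le i\le r-1$) have multiplicity $a$, and all other pairs have multiplicity $a+1$. $\Sigma_{r,d}(a,n)=\max\{e(G):G\in\mathcal{T}_{r,d}(a,n)\}$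 and $\Pi_{r,d}(a,n)=\max\{P(G):G\in\mathcal{T}_{r,d}(a,n)\}$. -}

module Defs where

open import Data.Nat using (ℕ; zero; suc; _+_; _*_; _∸_; _≤_; _⊔_)
open import Data.Fin using (Fin; zero; suc)
open import Data.Fin.Subset using (Subset; ∣_∣)
open import Data.Bool using (Bool; true; false; if_then_else_; _∧_)
open import Data.List using (List; []; _∷_; map; foldr; concatMap; allFin)
open import Data.Vec using (Vec; lookup) renaming ([] to []ᵥ; _∷_ to _∷ᵥ_)
open import Data.Product using (Σ; _×_)
open import Relation.Binary.PropositionalEquality using (_≡_)
open import Relation.Nullary.Decidable using (⌊_⌋)
import Data.Fin as F

sumPairs : (n : ℕ) → (Fin n → Fin n → ℕ) → ℕ
sumPairs zero    f = 0
sumPairs (suc n) f =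
  foldr _+_ 0 (map (λ j → f zero (suc j)) (allFin n))
  + sumPairs n (λ i j → f (suc i) (suc j))

prodPairs : (n : ℕ) → (Fin n → Fin n → ℕ) → ℕ
prodPairs zero    f = 1
prodPairs (suc n) f =
  foldr _*_ 1 (map (λ j → f zero (suc j)) (allFin n))
  * prodPairs n (λ i j → f (suc i) (suc j))

-- A multigraph on [n]: w i j is the multiplicity of the pair {i,j};
-- only the values with i < j are ever used.
Multigraph : ℕ → Set
Multigraph n = Fin n → Fin n → ℕ

eIn : {n : ℕ} → Multigraph n → Subset n → ℕ
eIn {n} w X = sumPairs n (λ i j → if lookup X i ∧ lookup X j then w i j else 0)

eG : {n : ℕ} → Multigraph n → ℕ
eG {n} w = sumPairs n w

PG : {n : ℕ} → Multigraph n → ℕ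
PG {n} w = prodPairs n w

InF : (n s q : ℕ) → Multigraph n → Set
InF n s q w = (X : Subset n) → ∣ X ∣ ≡ s → eIn w X ≤ q

ExPiEq : (n s q m : ℕ) → Set
ExPiEq n s q m =
  Σ (Multigraph n) (λ w → InF n s q w × (PG w ≡ m))
  × ((w : Multigraph n) → InF n s q w → PG w ≤ m)

-- The multigraph of T_{r,d}(a,n) determined by the part assignment c
-- (vertex v lies in part V_{c v}; parts may be empty).
partGraph : {n r : ℕ} → (a d : ℕ) → (Fin n → Fin r) → Multigraph n
partGraph a d c i j with ⌊ c i F.≟ c j ⌋
... | false = suc a
... | true  with c i
...   | zero  = a ∸ d
...   | suc _ = a

allAssign : (n r : ℕ) → List (Vec (Fin r) n)
allAssign zero    r = []ᵥ ∷ []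
allAssign (suc n) r =
  concatMap (λ x → map (x ∷ᵥ_) (allAssign n r)) (allFin r)

maxList : List ℕ → ℕ
maxList = foldr _⊔_ 0

SigmaT : (r d a n : ℕ) → ℕ
SigmaT r d a n = maxList (map (λ v → eG (partGraph a d (lookup v))) (allAssign n r))

PiT : (r d a n : ℕ) → ℕ
PiT r d a n = maxList (map (λ v → PG (partGraph a d (lookup v))) (allAssign n r))

{-# OPTIONS --safe #-}
module Submission where

-- Write p = a+1 and ρ = p/a. Every integer multiplicity w satisfies w ≤ p ρ^(w-p), so products
-- are controlled by sums, uniformly in a.
--
-- If every s-set of G spans at most Σ(s) edges, the hypothesis applies to G. Otherwise some s-set X
-- spans Σ(s)+t edges with t ≥ 1, so each of the m vertices outside X sends at most Σ(s+1)-Σ(s)-t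
-- edges to X. Write Σ(s+1)-Σ(s) = sp-g. Deleting X then costs G a factor of at most
-- p^(C(s,2)+sm) ρ^(1-m(g+1)), while for large a Π(m+s)/Π(m) is at least p^(C(s,2)+sm) times
-- ρ^(-(κ/E)(C(s,2)+sm)), where κ/E = (d+1)/B + 1/((s+1)B) and B = (r-1)(d+1)+1: a new vertex can
-- always join a part that is small relative to its weight. Removing a vertex from each part of a
-- colouring that attains Σ(s+1) shows s(d+1) < B(g+1), so deleting X loses a power of ρ growing
-- linearly in m. Iterating the deletion down to bounded size, where averaging gives P(G) ≤ p^C(n,2),
-- bounds P(G) by Π(n) times a power of ρ independent of a and n, and for large n one more deletion
-- absorbs it. Fractional exponents are avoided by raising everything to the power E.

open import Defs
open import Data.Bool using (true; false; if_then_else_; _∧_)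
open import Data.Fin using (Fin; zero; suc)
import Data.Fin as F
import Data.Fin.Properties as F
open import Data.Fin.Subset using (Subset; ∣_∣; inside; outside; ∁)
open import Data.Fin.Subset.Properties using (anySubset?)
open import Data.List using (List; []; _∷_; _++_; map; length; lookup; tabulate; allFin; filter)
open import Data.List.Membership.Propositional using (_∈_; lose)
open import Data.List.Membership.Propositional.Properties using (∈-map⁺; ∈-concatMap⁺; ∈-allFin; ∈-∃++)
open import Data.List.Properties
  using (length-map; length-++; length-tabulate; map-++; map-cong; map-tabulate; tabulate-cong;
         tabulate-lookup; ++-identityʳ; filter-accept; filter-reject)
open import Data.List.Relation.Binary.Permutation.Propositional as Perm
  using (_↭_; prep; swap; ↭-refl; ↭-reflexive; ↭-sym; ↭-trans)
open import Data.List.Relation.Binary.Permutation.Propositional.Properties as Perm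
  using (map⁺; shift; ↭-length; filter-↭)
open import Data.List.Relation.Binary.Sublist.Propositional using (_⊆_; []; _∷_; _∷ʳ_; ⊆-refl)
open import Data.List.Relation.Binary.Sublist.Propositional.Properties using (++⁺ʳ)
open import Data.List.Relation.Unary.All as All using (All; []; _∷_)
import Data.List.Relation.Unary.All.Properties as All
open import Data.List.Relation.Unary.Any using (here; there)
open import Data.Nat
open import Data.Nat.Induction using (<-rec)
open import Data.Nat.ListAction using (sum; product)
open import Data.Nat.ListAction.Properties using (sum-↭; product-↭; product-++)
open import Data.Nat.Properties
open import Data.Nat.Tactic.RingSolver using (solve-∀)
open import Data.Product using (Σ; ∃; _×_; _,_; proj₂)
open import Data.Sum using (_⊎_; inj₁; inj₂)
open import Data.Vec as Vec using (Vec; []; _∷_)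
open import Function using (_∘_; id)
open import Relation.Binary.PropositionalEquality
  using (_≡_; _≢_; refl; sym; trans; cong; cong₂; subst; subst₂; module ≡-Reasoning)
open import Relation.Nullary using (yes; no; contradiction)
open import Relation.Nullary.Decidable using (⌊_⌋; _×-dec_)

private variable
  A : Set
  n : ℕ

-- Sums and products of multiplicities over vertex lists.

degSum degProd : (A → A → ℕ) → A → List A → ℕ
degSum w x ys = sum (map (w x) ys)
degProd w x ys = product (map (w x) ys)

-- Vertex sets are carried as lists, so that deleting vertices leaves an object of the same kind and
-- nothing has to be renumbered.
edgeSum edgeProd : (A → A → ℕ) → List A → ℕ
edgeSum w []       = 0
edgeSum w (x ∷ xs) = degSum w x xs + edgeSum w xs
edgeProd w []       = 1
edgeProd w (x ∷ xs) = degProd w x xs * edgeProd w xs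

Symm : (A → A → ℕ) → Set
Symm w = ∀ x y → w x y ≡ w y x

edgeSum-↭ : {w : A → A → ℕ} → Symm w → ∀ {xs ys} → xs ↭ ys → edgeSum w xs ≡ edgeSum w ys
edgeSum-↭ w-sym Perm.refl = refl
edgeSum-↭ {w = w} w-sym (prep x p) = cong₂ _+_ (sum-↭ (map⁺ (w x) p)) (edgeSum-↭ w-sym p)
edgeSum-↭ {w = w} w-sym (swap {xs} {ys} x y p)
  rewrite w-sym x y | sum-↭ (map⁺ (w x) p) | sum-↭ (map⁺ (w y) p) | edgeSum-↭ w-sym p =
  exchange (w y x) (degSum w x ys) (degSum w y ys) (edgeSum w ys)
  where
  exchange : ∀ a b c e → a + b + (c + e) ≡ a + c + (b + e)
  exchange = solve-∀
edgeSum-↭ w-sym (Perm.trans p q) = trans (edgeSum-↭ w-sym p) (edgeSum-↭ w-sym q)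

edgeProd-↭ : {w : A → A → ℕ} → Symm w → ∀ {xs ys} → xs ↭ ys → edgeProd w xs ≡ edgeProd w ys
edgeProd-↭ w-sym Perm.refl = refl
edgeProd-↭ {w = w} w-sym (prep x p) = cong₂ _*_ (product-↭ (map⁺ (w x) p)) (edgeProd-↭ w-sym p)
edgeProd-↭ {w = w} w-sym (swap {xs} {ys} x y p)
  rewrite w-sym x y | product-↭ (map⁺ (w x) p) | product-↭ (map⁺ (w y) p) | edgeProd-↭ w-sym p =
  exchange (w y x) (degProd w x ys) (degProd w y ys) (edgeProd w ys)
  where
  exchange : ∀ a b c e → a * b * (c * e) ≡ a * c * (b * e)
  exchange = solve-∀
edgeProd-↭ w-sym (Perm.trans p q) = trans (edgeProd-↭ w-sym p) (edgeProd-↭ w-sym q)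

-- The cross pairs are grouped by the vertices of the first list: with the outside vertices in
-- front, each contributes its degree product into the deleted set.
edgeProd-++ : (w : A → A → ℕ) (zs xs : List A) →
  edgeProd w (zs ++ xs) ≡ edgeProd w zs * (product (map (λ z → degProd w z xs) zs) * edgeProd w xs)
edgeProd-++ w [] xs = sym (trans (*-identityˡ _) (*-identityˡ _))
edgeProd-++ w (z ∷ zs) xs
  rewrite map-++ (w z) zs xs | product-++ (map (w z) zs) (map (w z) xs) | edgeProd-++ w zs xs =
  rearrange (degProd w z zs) (degProd w z xs) (edgeProd w zs) _ (edgeProd w xs)
  where
  rearrange : ∀ a b c e f → a * b * (c * (e * f)) ≡ a * c * (b * e * f)
  rearrange = solve-∀

-- Subsets of `Fin n` as vertex lists.

select : Subset n → (Fin n → A) → List A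
select []            f = []
select (inside ∷ X)  f = f zero ∷ select X (f ∘ suc)
select (outside ∷ X) f = select X (f ∘ suc)

length-select : (X : Subset n) (f : Fin n → A) → length (select X f) ≡ ∣ X ∣
length-select []            f = refl
length-select (inside ∷ X)  f = cong suc (length-select X (f ∘ suc))
length-select (outside ∷ X) f = length-select X (f ∘ suc)

select-∁-↭ : (X : Subset n) (f : Fin n → A) → select X f ++ select (∁ X) f ↭ tabulate f
select-∁-↭ []            f = ↭-refl
select-∁-↭ (inside ∷ X)  f = prep (f zero) (select-∁-↭ X (f ∘ suc))
select-∁-↭ (outside ∷ X) f =
  ↭-trans (shift (f zero) (select X (f ∘ suc)) _) (prep (f zero) (select-∁-↭ X (f ∘ suc)))

⊆-tabulate⇒select : (f : Fin n → A) {ys : List A} → ys ⊆ tabulate f → ∃ λ X → select X f ≡ ys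
⊆-tabulate⇒select {zero}  f []         = [] , refl
⊆-tabulate⇒select {suc n} f (_ ∷ʳ p)   with ⊆-tabulate⇒select (f ∘ suc) p
... | X , refl = outside ∷ X , refl
⊆-tabulate⇒select {suc n} f (refl ∷ p) with ⊆-tabulate⇒select (f ∘ suc) p
... | X , refl = inside ∷ X , refl

⊆-↭-commute : {us vs ys : List A} → us ↭ vs → ys ⊆ us → ∃ λ zs → zs ⊆ vs × ys ↭ zs
⊆-↭-commute Perm.refl p = _ , p , ↭-refl
⊆-↭-commute (prep x σ) (_ ∷ʳ p) with ⊆-↭-commute σ p
... | zs , q , τ = zs , x ∷ʳ q , τ
⊆-↭-commute (prep x σ) (refl ∷ p) with ⊆-↭-commute σ p
... | zs , q , τ = x ∷ zs , refl ∷ q , prep x τ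
⊆-↭-commute (swap x y σ) (_ ∷ʳ _ ∷ʳ p) with ⊆-↭-commute σ p
... | zs , q , τ = zs , y ∷ʳ x ∷ʳ q , τ
⊆-↭-commute (swap x y σ) (_ ∷ʳ refl ∷ p) with ⊆-↭-commute σ p
... | zs , q , τ = y ∷ zs , refl ∷ x ∷ʳ q , prep y τ
⊆-↭-commute (swap x y σ) (refl ∷ _ ∷ʳ p) with ⊆-↭-commute σ p
... | zs , q , τ = x ∷ zs , y ∷ʳ refl ∷ q , prep x τ
⊆-↭-commute (swap x y σ) (refl ∷ refl ∷ p) with ⊆-↭-commute σ p
... | zs , q , τ = y ∷ x ∷ zs , refl ∷ refl ∷ q , swap x y τ
⊆-↭-commute (Perm.trans σ σ′) p with ⊆-↭-commute σ p
... | zs , q , τ with ⊆-↭-commute σ′ q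
...   | zs′ , q′ , τ′ = zs′ , q′ , ↭-trans τ τ′

-- A part in the sense of `Bounded` may come in any order, while `select` follows the order of `f`;
-- hence the subset is recovered only up to permutation.
select-↭ : (f : Fin n → A) (ys zs : List A) → ys ++ zs ↭ tabulate f → ∃ λ X → ys ↭ select X f
select-↭ f ys zs σ with ⊆-↭-commute σ (++⁺ʳ zs ⊆-refl)
... | ys′ , p , τ with ⊆-tabulate⇒select f p
...   | X , refl = X , τ

sum-zeros : ∀ n → sum (tabulate {n = n} (λ _ → 0)) ≡ 0
sum-zeros zero    = refl
sum-zeros (suc n) = sum-zeros n

row-select : (X : Subset n) (f : Fin n → A) (g : A → ℕ) →
  sum (tabulate (λ j → if Vec.lookup X j then g (f j) else 0)) ≡ sum (map g (select X f))
row-select []            f g = refl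
row-select (inside ∷ X)  f g = cong (g (f zero) +_) (row-select X (f ∘ suc) g)
row-select (outside ∷ X) f g = row-select X (f ∘ suc) g

-- Labels in an arbitrary type let one identity serve both for vertices, with `f` a numbering, and
-- for colours, with `f` a part assignment.
eIn-select : (w : A → A → ℕ) (f : Fin n → A) (X : Subset n) →
  eIn (λ i j → w (f i) (f j)) X ≡ edgeSum w (select X f)
eIn-select w f [] = refl
eIn-select {n = suc n} w f (inside ∷ X) = cong₂ _+_
  (trans (cong sum (map-tabulate {n = n} id _)) (row-select X (f ∘ suc) (w (f zero))))
  (eIn-select w (f ∘ suc) X)
eIn-select {n = suc n} w f (outside ∷ X) = cong₂ _+_
  (trans (cong sum (map-tabulate {n = n} id _)) (sum-zeros n))
  (eIn-select w (f ∘ suc) X)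

eG-tabulate : (w : A → A → ℕ) (f : Fin n → A) →
  eG (λ i j → w (f i) (f j)) ≡ edgeSum w (tabulate f)
eG-tabulate {n = zero}  w f = refl
eG-tabulate {n = suc n} w f = cong₂ _+_
  (cong sum (trans (map-tabulate {n = n} id _) (sym (map-tabulate (f ∘ suc) _))))
  (eG-tabulate w (f ∘ suc))

PG-tabulate : (w : A → A → ℕ) (f : Fin n → A) →
  PG (λ i j → w (f i) (f j)) ≡ edgeProd w (tabulate f)
PG-tabulate {n = zero}  w f = refl
PG-tabulate {n = suc n} w f = cong₂ _*_
  (cong product (trans (map-tabulate {n = n} id _) (sym (map-tabulate (f ∘ suc) _))))
  (PG-tabulate w (f ∘ suc))

-- Symmetric multiplicities.

sumPairs-cong : ∀ n {f g : Multigraph n} → (∀ {i j} → i F.< j → f i j ≡ g i j) → sumPairs n f ≡ sumPairs n g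
sumPairs-cong zero    f≗g = refl
sumPairs-cong (suc n) f≗g = cong₂ _+_
  (cong sum (map-cong (λ j → f≗g {zero} {suc j} z<s) (allFin n)))
  (sumPairs-cong n (λ i<j → f≗g (s<s i<j)))

prodPairs-cong : ∀ n {f g : Multigraph n} → (∀ {i j} → i F.< j → f i j ≡ g i j) → prodPairs n f ≡ prodPairs n g
prodPairs-cong zero    f≗g = refl
prodPairs-cong (suc n) f≗g = cong₂ _*_
  (cong product (map-cong (λ j → f≗g {zero} {suc j} z<s) (allFin n)))
  (prodPairs-cong n (λ i<j → f≗g (s<s i<j)))

eIn-cong : {v w : Multigraph n} → (∀ {i j} → i F.< j → v i j ≡ w i j) → ∀ X → eIn v X ≡ eIn w X
eIn-cong {n} v≗w X = sumPairs-cong n λ {i} {j} i<j →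
  cong (if Vec.lookup X i ∧ Vec.lookup X j then_else 0) (v≗w i<j)

-- A multigraph only fixes the entries with `i < j`, but reordering a vertex list requires a
-- symmetric `w`.
symmetrise : Multigraph n → Multigraph n
symmetrise w zero    zero    = 0
symmetrise w zero    (suc j) = w zero (suc j)
symmetrise w (suc i) zero    = w zero (suc i)
symmetrise w (suc i) (suc j) = symmetrise (λ i j → w (suc i) (suc j)) i j

symmetrise-Symm : (w : Multigraph n) → Symm (symmetrise w)
symmetrise-Symm w zero    zero    = refl
symmetrise-Symm w zero    (suc j) = refl
symmetrise-Symm w (suc i) zero    = refl
symmetrise-Symm w (suc i) (suc j) = symmetrise-Symm (λ i j → w (suc i) (suc j)) i j

symmetrise-< : (w : Multigraph n) {i j : Fin n} → i F.< j → symmetrise w i j ≡ w i j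
symmetrise-< w {zero}  {suc j} _   = refl
symmetrise-< w {suc i} {suc j} i<j = symmetrise-< (λ i j → w (suc i) (suc j)) (s<s⁻¹ i<j)

-- Comparison up to powers of ρ.

^-distribʳ-* : ∀ m n k → (m * n) ^ k ≡ m ^ k * n ^ k
^-distribʳ-* m n zero    = refl
^-distribʳ-* m n (suc k) rewrite ^-distribʳ-* m n k = rearrange m n (m ^ k) (n ^ k)
  where
  rearrange : ∀ a b c e → a * b * (c * e) ≡ a * c * (b * e)
  rearrange = solve-∀

^-cancel-≤ : ∀ {x y} k .{{_ : NonZero k}} → x ^ k ≤ y ^ k → x ≤ y
^-cancel-≤ {x} {y} k u = ≮⇒≥ λ y<x → <⇒≱ (^-monoˡ-< k y<x) u

-- The binomial coefficient C(n,2), in the recursion that `edgeSum` follows.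
pairs : ℕ → ℕ
pairs zero    = 0
pairs (suc n) = n + pairs n

module Ratio (a : ℕ) .{{_ : NonZero a}} where

  p : ℕ
  p = suc a

  -- x ≼ y ρ[ i - j ] means x ≤ y ρ^(i-j) for ρ = (a+1)/a, with denominators cleared.
  infix 4 _≼_ρ[_-_]
  record _≼_ρ[_-_] (x y i j : ℕ) : Set where
    constructor mk
    field cleared : x * (p ^ j * a ^ i) ≤ y * (p ^ i * a ^ j)
  open _≼_ρ[_-_]

  ≼-≤ : ∀ {x y} → x ≤ y → x ≼ y ρ[ 0 - 0 ]
  ≼-≤ x≤y = mk (*-monoˡ-≤ 1 x≤y)

  ≼-trans : ∀ {x y z i j k l} → x ≼ y ρ[ i - j ] → y ≼ z ρ[ k - l ] → x ≼ z ρ[ i + k - (j + l) ]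
  ≼-trans {x} {y} {z} {i} {j} {k} {l} (mk u) (mk v) = mk (begin
    x * (p ^ (j + l) * a ^ (i + k))
      ≡⟨ cong₂ (λ b c → x * (b * c)) (^-distribˡ-+-* p j l) (^-distribˡ-+-* a i k) ⟩
    x * (p ^ j * p ^ l * (a ^ i * a ^ k))     ≡⟨ e₁ x (p ^ j) (p ^ l) (a ^ i) (a ^ k) ⟩
    x * (p ^ j * a ^ i) * (p ^ l * a ^ k)     ≤⟨ *-monoˡ-≤ _ u ⟩
    y * (p ^ i * a ^ j) * (p ^ l * a ^ k)     ≡⟨ e₂ y (p ^ i * a ^ j) (p ^ l * a ^ k) ⟩
    y * (p ^ l * a ^ k) * (p ^ i * a ^ j)     ≤⟨ *-monoˡ-≤ _ v ⟩
    z * (p ^ k * a ^ l) * (p ^ i * a ^ j)     ≡⟨ e₃ z (p ^ k) (a ^ l) (p ^ i) (a ^ j) ⟩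
    z * (p ^ i * p ^ k * (a ^ j * a ^ l))
      ≡⟨ cong₂ (λ b c → z * (b * c)) (^-distribˡ-+-* p i k) (^-distribˡ-+-* a j l) ⟨
    z * (p ^ (i + k) * a ^ (j + l))           ∎)
    where
    open ≤-Reasoning
    e₁ : ∀ x a b c e → x * (a * b * (c * e)) ≡ x * (a * c) * (b * e)
    e₁ = solve-∀
    e₂ : ∀ x a b → x * a * b ≡ x * b * a
    e₂ = solve-∀
    e₃ : ∀ x a b c e → x * (a * b) * (c * e) ≡ x * (c * a * (e * b))
    e₃ = solve-∀

  ≼-* : ∀ {x y z t i j k l} → x ≼ y ρ[ i - j ] → z ≼ t ρ[ k - l ] → x * z ≼ y * t ρ[ i + k - (j + l) ]
  ≼-* {x} {y} {z} {t} {i} {j} {k} {l} (mk u) (mk v) = mk (begin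
    x * z * (p ^ (j + l) * a ^ (i + k))
      ≡⟨ cong₂ (λ b c → x * z * (b * c)) (^-distribˡ-+-* p j l) (^-distribˡ-+-* a i k) ⟩
    x * z * (p ^ j * p ^ l * (a ^ i * a ^ k))     ≡⟨ e₁ x z (p ^ j) (p ^ l) (a ^ i) (a ^ k) ⟩
    x * (p ^ j * a ^ i) * (z * (p ^ l * a ^ k))   ≤⟨ *-mono-≤ u v ⟩
    y * (p ^ i * a ^ j) * (t * (p ^ k * a ^ l))   ≡⟨ e₁ y t (p ^ i) (p ^ k) (a ^ j) (a ^ l) ⟨
    y * t * (p ^ i * p ^ k * (a ^ j * a ^ l))
      ≡⟨ cong₂ (λ b c → y * t * (b * c)) (^-distribˡ-+-* p i k) (^-distribˡ-+-* a j l) ⟨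
    y * t * (p ^ (i + k) * a ^ (j + l))           ∎)
    where
    open ≤-Reasoning
    e₁ : ∀ x z a b c e → x * z * (a * b * (c * e)) ≡ x * (a * c) * (z * (b * e))
    e₁ = solve-∀

  ≼-^ : ∀ {x y i j} k → x ≼ y ρ[ i - j ] → x ^ k ≼ y ^ k ρ[ k * i - k * j ]
  ≼-^ zero    u = ≼-≤ ≤-refl
  ≼-^ (suc k) u = ≼-* u (≼-^ k u)

  a^-p^-mono : ∀ {i j} → i ≤ j → p ^ i * a ^ j ≤ p ^ j * a ^ i
  a^-p^-mono {i} {j} i≤j with k , refl ← m≤n⇒∃[o]m+o≡n i≤j = go i k
    where
    open ≤-Reasoning
    e₁ : ∀ x y z → x * (y * z) ≡ x * z * y
    e₁ = solve-∀
    go : ∀ i k → p ^ i * a ^ (i + k) ≤ p ^ (i + k) * a ^ i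
    go i k = begin
      p ^ i * a ^ (i + k)      ≡⟨ cong (p ^ i *_) (^-distribˡ-+-* a i k) ⟩
      p ^ i * (a ^ i * a ^ k)  ≤⟨ *-monoʳ-≤ (p ^ i) (*-monoʳ-≤ (a ^ i) (^-monoˡ-≤ k (n≤1+n a))) ⟩
      p ^ i * (a ^ i * p ^ k)  ≡⟨ e₁ (p ^ i) (a ^ i) (p ^ k) ⟩
      p ^ i * p ^ k * a ^ i    ≡⟨ cong (_* a ^ i) (^-distribˡ-+-* p i k) ⟨
      p ^ (i + k) * a ^ i      ∎

  -- Only the difference of the two exponents matters, and since ρ ≥ 1 it may grow. The differences
  -- are compared without subtraction.
  ≼-weaken : ∀ {x y i j k l} → i + l ≤ k + j → x ≼ y ρ[ i - j ] → x ≼ y ρ[ k - l ]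
  ≼-weaken {x} {y} {i} {j} {k} {l} le (mk u) = mk (*-cancelʳ-≤ _ _ (p ^ j * a ^ i) {{nz}} (begin
    x * (p ^ l * a ^ k) * (p ^ j * a ^ i)  ≡⟨ e₁ x (p ^ l * a ^ k) (p ^ j * a ^ i) ⟩
    x * (p ^ j * a ^ i) * (p ^ l * a ^ k)  ≤⟨ *-monoˡ-≤ _ u ⟩
    y * (p ^ i * a ^ j) * (p ^ l * a ^ k)  ≡⟨ e₂ y (p ^ i) (a ^ j) (p ^ l) (a ^ k) ⟩
    y * (p ^ i * p ^ l * (a ^ k * a ^ j))
      ≡⟨ cong₂ (λ b c → y * (b * c)) (^-distribˡ-+-* p i l) (^-distribˡ-+-* a k j) ⟨
    y * (p ^ (i + l) * a ^ (k + j))        ≤⟨ *-monoʳ-≤ y (a^-p^-mono le) ⟩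
    y * (p ^ (k + j) * a ^ (i + l))
      ≡⟨ cong₂ (λ b c → y * (b * c)) (^-distribˡ-+-* p k j) (^-distribˡ-+-* a i l) ⟩
    y * (p ^ k * p ^ j * (a ^ i * a ^ l))  ≡⟨ e₃ y (p ^ k) (p ^ j) (a ^ i) (a ^ l) ⟩
    y * (p ^ k * a ^ l) * (p ^ j * a ^ i)  ∎))
    where
    open ≤-Reasoning
    nz : NonZero (p ^ j * a ^ i)
    nz = m*n≢0 _ _ {{m^n≢0 p j}} {{m^n≢0 a i}}
    e₁ : ∀ x a b → x * a * b ≡ x * b * a
    e₁ = solve-∀
    e₂ : ∀ x a b c e → x * (a * b) * (c * e) ≡ x * (a * c * (e * b))
    e₂ = solve-∀
    e₃ : ∀ x a b c e → x * (a * b * (c * e)) ≡ x * (a * e) * (b * c)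
    e₃ = solve-∀

  ≼⇒≤ : ∀ {x y} → x ≼ y ρ[ 0 - 0 ] → x ≤ y
  ≼⇒≤ {x} {y} (mk u) = *-cancelʳ-≤ x y 1 u

  -- The chord of log through a and a+1 lies above log at every other integer.
  tangent : ∀ w → w ≼ p ρ[ w - p ]
  tangent w with ≤-total p w
  ... | inj₁ p≤w = subst (λ w → w ≼ p ρ[ w - p ]) (m∸n+n≡m p≤w) (up (w ∸ p))
    where
    step : ∀ k → suc (k + p) ≼ k + p ρ[ 1 - 0 ]
    step k = mk (subst₂ _≤_ (e₁ (k + p) a) (e₂ (k + p) a)
      (+-monoʳ-≤ (a * (k + p)) (≤-trans (n≤1+n a) (m≤n+m p k))))
      where
      e₁ : ∀ x a → a * x + a ≡ suc x * (1 * (a * 1))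
      e₁ = solve-∀
      e₂ : ∀ x a → a * x + x ≡ x * (suc a * 1 * 1)
      e₂ = solve-∀
    up : ∀ k → k + p ≼ p ρ[ k + p - p ]
    up zero    = ≼-weaken (≤-reflexive (+-comm 0 p)) (≼-≤ ≤-refl)
    up (suc k) = ≼-trans (step k) (up k)
  ... | inj₂ w≤p = down (p ∸ w) w (m+[n∸m]≡n w≤p)
    where
    -- For `w ≤ a` one has `w (a + 1) ≤ (w + 1) a`, so each step down from `p` loses at least a
    -- factor ρ.
    step : ∀ w → w ≤ a → w ≼ suc w ρ[ 0 - 1 ]
    step w w≤a = mk (subst₂ _≤_ (e₁ w a) (e₂ w a) (+-monoʳ-≤ (a * w) w≤a))
      where
      e₁ : ∀ x a → a * x + x ≡ x * (suc a * 1 * 1)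
      e₁ = solve-∀
      e₂ : ∀ x a → a * x + a ≡ suc x * (1 * (a * 1))
      e₂ = solve-∀
    down : ∀ k w → w + k ≡ p → w ≼ p ρ[ w - p ]
    down zero w eq rewrite trans (sym (+-identityʳ w)) eq =
      ≼-weaken (≤-reflexive (+-comm 0 p)) (≼-≤ ≤-refl)
    down (suc k) w eq = ≼-weaken (≤-reflexive (sym (+-suc w p)))
      (≼-trans (step w (s≤s⁻¹ w<p)) (down k (suc w) (trans (sym (+-suc w k)) eq)))
      where
      w<p : suc w ≤ p
      w<p = subst (suc w ≤_) (trans (sym (+-suc w k)) eq) (m≤m+n (suc w) k)

  -- The tangent bounds multiply, leaving only the sum of the factors in the exponent. This is how
  -- bounds on edge counts become bounds on products.
  product-≼ : ∀ us → product us ≼ p ^ length us ρ[ sum us - length us * p ]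
  product-≼ []       = ≼-≤ ≤-refl
  product-≼ (u ∷ us) = ≼-* (tangent u) (product-≼ us)

  degProd-≼ : (w : A → A → ℕ) (x : A) (ys : List A) →
    degProd w x ys ≼ p ^ length ys ρ[ degSum w x ys - length ys * p ]
  degProd-≼ w x ys = subst (λ k → degProd w x ys ≼ p ^ k ρ[ degSum w x ys - k * p ])
    (length-map (w x) ys) (product-≼ (map (w x) ys))

  edgeProd-≼ : (w : A → A → ℕ) (xs : List A) →
    edgeProd w xs ≼ p ^ pairs (length xs) ρ[ edgeSum w xs - pairs (length xs) * p ]
  edgeProd-≼ w []       = ≼-≤ ≤-refl
  edgeProd-≼ w (x ∷ xs)
    rewrite ^-distribˡ-+-* p (length xs) (pairs (length xs))
          | *-distribʳ-+ p (length xs) (pairs (length xs)) =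
    ≼-* (degProd-≼ w x xs) (edgeProd-≼ w xs)

  products-≼ : (f : A → ℕ) {y i j : ℕ} (zs : List A) → All (λ z → f z ≼ y ρ[ i - j ]) zs →
    product (map f zs) ≼ y ^ length zs ρ[ length zs * i - length zs * j ]
  products-≼ f []       []       = ≼-≤ ≤-refl
  products-≼ f (z ∷ zs) (u ∷ us) = ≼-* u (products-≼ f zs us)

-- Bounded vertex lists and averaging over deletions.

Bounded : (A → A → ℕ) → (k q : ℕ) → List A → Set
Bounded w k q l = ∀ ys zs → ys ++ zs ↭ l → length ys ≡ k → edgeSum w ys ≤ q

-- `Bounded` quantifies over the complement `zs` too, so heredity amounts to appending the vertices
-- outside `xs` to it.
Bounded-part : {w : A → A → ℕ} {k q : ℕ} {l xs us : List A} → xs ++ us ↭ l → Bounded w k q l → Bounded w k q xs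
Bounded-part {us = us} σ b ys zs τ = b ys (zs ++ us)
  (↭-trans (↭-sym (Perm.++-assoc ys zs us)) (↭-trans (Perm.++⁺ʳ us τ) σ))

removals : List A → List (List A)
removals []       = []
removals (x ∷ xs) = xs ∷ map (x ∷_) (removals xs)

length-removals : (xs : List A) → length (removals xs) ≡ length xs
length-removals []       = refl
length-removals (x ∷ xs) = cong suc (trans (length-map (x ∷_) (removals xs)) (length-removals xs))

removals-↭ : (xs : List A) → All (λ r → ∃ λ v → v ∷ r ↭ xs) (removals xs)
removals-↭ []       = []
removals-↭ (x ∷ xs) = (x , ↭-refl) ∷
  All.map⁺ (All.map (λ (v , σ) → v , ↭-trans (swap v x ↭-refl) (prep x σ)) (removals-↭ xs))

sum-removals : (g : A → ℕ) (xs : List A) →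
  sum (map (λ r → sum (map g r)) (removals xs)) + sum (map g xs) ≡ length xs * sum (map g xs)
sum-removals g []       = refl
sum-removals g (x ∷ xs) = begin
  s + sum (map (λ r → sum (map g r)) (map (x ∷_) (removals xs))) + (g x + s)
    ≡⟨ cong (λ t → s + t + (g x + s)) (cons (removals xs)) ⟩
  s + (length (removals xs) * g x + sum (map (λ r → sum (map g r)) (removals xs))) + (g x + s)
    ≡⟨ cong (λ t → s + (t * g x + sum (map (λ r → sum (map g r)) (removals xs))) + (g x + s))
         (length-removals xs) ⟩
  s + (length xs * g x + sum (map (λ r → sum (map g r)) (removals xs))) + (g x + s)
    ≡⟨ e₁ s (length xs) (g x) _ ⟩
  g x + s + length xs * g x + (sum (map (λ r → sum (map g r)) (removals xs)) + s)
    ≡⟨ cong (g x + s + length xs * g x +_) (sum-removals g xs) ⟩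
  g x + s + length xs * g x + length xs * s
    ≡⟨ e₂ (g x) s (length xs) ⟩
  suc (length xs) * (g x + s) ∎
  where
  open ≡-Reasoning
  s : ℕ
  s = sum (map g xs)
  cons : ∀ rs → sum (map (λ r → sum (map g r)) (map (x ∷_) rs)) ≡
    length rs * g x + sum (map (λ r → sum (map g r)) rs)
  cons []       = refl
  cons (r ∷ rs) rewrite cons rs = e (g x) (sum (map g r)) (length rs * g x) _
    where
    e : ∀ a b c f → a + b + (c + f) ≡ a + c + (b + f)
    e = solve-∀
  e₁ : ∀ s n x t → s + (n * x + t) + (x + s) ≡ x + s + n * x + (t + s)
  e₁ = solve-∀
  e₂ : ∀ x s n → x + s + n * x + n * s ≡ suc n * (x + s)
  e₂ = solve-∀

-- Each pair is missing from exactly two removals, those of its endpoints.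
edgeSum-removals : (w : A → A → ℕ) (xs : List A) →
  sum (map (edgeSum w) (removals xs)) + 2 * edgeSum w xs ≡ length xs * edgeSum w xs
edgeSum-removals w []       = refl
edgeSum-removals w (x ∷ xs) = begin
  e + sum (map (edgeSum w) (map (x ∷_) (removals xs))) + 2 * (δ + e)
    ≡⟨ cong (λ t → e + t + 2 * (δ + e)) (cons (removals xs)) ⟩
  e + (Sδ + Se) + 2 * (δ + e)      ≡⟨ e₁ e Sδ Se δ ⟩
  e + (Sδ + δ) + (Se + 2 * e) + δ  ≡⟨ cong₂ (λ s t → e + s + t + δ) (sum-removals (w x) xs) (edgeSum-removals w xs) ⟩
  e + length xs * δ + length xs * e + δ  ≡⟨ e₂ e (length xs) δ ⟩
  suc (length xs) * (δ + e) ∎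
  where
  open ≡-Reasoning
  e δ Sδ Se : ℕ
  e = edgeSum w xs
  δ = degSum w x xs
  Sδ = sum (map (degSum w x) (removals xs))
  Se = sum (map (edgeSum w) (removals xs))
  cons : ∀ rs → sum (map (edgeSum w) (map (x ∷_) rs)) ≡
    sum (map (degSum w x) rs) + sum (map (edgeSum w) rs)
  cons []       = refl
  cons (r ∷ rs) rewrite cons rs = e₀ (degSum w x r) (edgeSum w r) (sum (map (degSum w x) rs)) _
    where
    e₀ : ∀ a b c f → a + b + (c + f) ≡ a + c + (b + f)
    e₀ = solve-∀
  e₁ : ∀ e s t δ → e + (s + t) + 2 * (δ + e) ≡ e + (s + δ) + (t + 2 * e) + δ
  e₁ = solve-∀
  e₂ : ∀ e n δ → e + n * δ + n * e + δ ≡ suc n * (δ + e)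
  e₂ = solve-∀

sum-≤ : (f : A → ℕ) {q : ℕ} (xs : List A) → All (λ x → f x ≤ q) xs → sum (map f xs) ≤ length xs * q
sum-≤ f []       []       = z≤n
sum-≤ f (x ∷ xs) (u ∷ us) = +-mono-≤ u (sum-≤ f xs us)

2*pairs : ∀ n → 2 * pairs (suc n) ≡ n * suc n
2*pairs zero    = refl
2*pairs (suc n) = trans (e₁ n (pairs (suc n))) (trans (cong (2 * suc n +_) (2*pairs n)) (e₂ n))
  where
  e₁ : ∀ n q → 2 * (suc n + q) ≡ 2 * suc n + 2 * q
  e₁ = solve-∀
  e₂ : ∀ n → 2 * suc n + n * suc n ≡ suc n * suc (suc n)
  e₂ = solve-∀

-- Induction on the number `j` of vertices beyond `k + 2`. Averaging over the deletions of one of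
-- `n` vertices gives `(n - 2) e(l) ≤ n C(n-1,2) p = (n - 2) C(n,2) p`, and `n - 2 > 0` cancels.
edgeSum-average : (w : A → A → ℕ) (k p j : ℕ) (l : List A) → length l ≡ j + suc (suc k) →
  Bounded w (suc (suc k)) (pairs (suc (suc k)) * p) l → edgeSum w l ≤ pairs (length l) * p
edgeSum-average w k p zero l len b = ≤-trans (b l [] (↭-reflexive (++-identityʳ l)) len)
  (≤-reflexive (cong (λ n → pairs n * p) (sym len)))
edgeSum-average w k p (suc j) l len b = subst (λ n → edgeSum w l ≤ pairs n * p) (sym len′)
  (*-cancelˡ-≤ (suc m) (+-cancelʳ-≤ (2 * edgeSum w l) _ _ (begin
    suc m * edgeSum w l + 2 * edgeSum w l               ≡⟨ e₁ m (edgeSum w l) ⟩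
    (3 + m) * edgeSum w l                               ≡⟨ cong (_* edgeSum w l) len′ ⟨
    length l * edgeSum w l                              ≡⟨ edgeSum-removals w l ⟨
    sum (map (edgeSum w) (removals l)) + 2 * edgeSum w l
      ≤⟨ +-monoˡ-≤ _ (sum-≤ (edgeSum w) (removals l) (All.map bound (removals-↭ l))) ⟩
    length (removals l) * (pairs (2 + m) * p) + 2 * edgeSum w l
      ≡⟨ cong (λ t → t * (pairs (2 + m) * p) + 2 * edgeSum w l) (trans (length-removals l) len′) ⟩
    (3 + m) * (pairs (2 + m) * p) + 2 * edgeSum w l
      ≡⟨ cong (_+ 2 * edgeSum w l) (count m p (pairs (2 + m)) (2*pairs (suc m))) ⟩
    suc m * (pairs (3 + m) * p) + 2 * edgeSum w l       ∎)))
  where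
  open ≤-Reasoning
  m : ℕ
  m = j + k
  len′ : length l ≡ 3 + m
  len′ = trans len (e j k)
    where
    e : ∀ j k → suc j + suc (suc k) ≡ 3 + (j + k)
    e = solve-∀
  e₁ : ∀ m e → suc m * e + 2 * e ≡ (3 + m) * e
  e₁ = solve-∀
  count : ∀ m p q → 2 * q ≡ suc m * suc (suc m) → (3 + m) * (q * p) ≡ suc m * ((2 + m + q) * p)
  count m p q eq = trans (e₂ m p q) (trans (cong (λ t → suc m * q * p + t * p) eq) (e₃ m p q))
    where
    e₂ : ∀ m p q → (3 + m) * (q * p) ≡ suc m * q * p + 2 * q * p
    e₂ = solve-∀
    e₃ : ∀ m p q → suc m * q * p + suc m * suc (suc m) * p ≡ suc m * ((2 + m + q) * p)
    e₃ = solve-∀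
  bound : ∀ {r} → ∃ (λ v → v ∷ r ↭ l) → edgeSum w r ≤ pairs (2 + m) * p
  bound {r} (v , σ) = subst (λ n → edgeSum w r ≤ pairs n * p) lr
    (edgeSum-average w k p j r (trans lr (e j k)) (Bounded-part (↭-trans (Perm.++-comm r _) σ) b))
    where
    lr : length r ≡ 2 + m
    lr = suc-injective (trans (↭-length σ) len′)
    e : ∀ j k → 2 + (j + k) ≡ j + suc (suc k)
    e = solve-∀

-- The maxima Σ and Π over colour lists.

maxList-upper : ∀ {x xs} → x ∈ xs → x ≤ maxList xs
maxList-upper {xs = _ ∷ xs} (here refl) = m≤m⊔n _ (maxList xs)
maxList-upper {xs = y ∷ xs} (there x∈)  = ≤-trans (maxList-upper x∈) (m≤n⊔m y _)

maxList-attained : (f : A → ℕ) {x : A} {xs : List A} → x ∈ xs → ∃ λ y → maxList (map f xs) ≡ f y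
maxList-attained f {xs = y ∷ []}     _ = y , ⊔-identityʳ (f y)
maxList-attained f {xs = y ∷ z ∷ zs} _
  with maxList-attained f {z} {z ∷ zs} (here refl) | ⊔-sel (f y) (maxList (map f (z ∷ zs)))
... | _       | inj₁ eq = y , eq
... | t , eq′ | inj₂ eq = t , trans eq eq′

∈-allAssign : ∀ {r} (v : Vec (Fin r) n) → v ∈ allAssign n r
∈-allAssign []      = here refl
∈-allAssign {r = r} (x ∷ v) = ∈-concatMap⁺ _ (lose (∈-allFin x) (∈-map⁺ (x ∷_) (∈-allAssign v)))

-- A multiplicity in `partGraph` depends only on the two colours, so each graph in the family is a
-- pull-back of this one weight and is described by its list of colours.
colourWeight : (a d : ℕ) {r : ℕ} → Fin r → Fin r → ℕ
colourWeight a d = partGraph a d id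

partGraph-colourWeight : ∀ a d {r} (c : Fin n → Fin r) i j → partGraph a d c i j ≡ colourWeight a d (c i) (c j)
partGraph-colourWeight a d c i j with ⌊ c i F.≟ c j ⌋
... | false = refl
... | true with c i
...   | zero  = refl
...   | suc _ = refl

tabulate-fromList : (xs : List A) → tabulate (Vec.lookup (Vec.fromList xs)) ≡ xs
tabulate-fromList []       = refl
tabulate-fromList (x ∷ xs) = cong (x ∷_) (tabulate-fromList xs)

eG-partGraph : ∀ a d {r} (c : Fin n → Fin r) → eG (partGraph a d c) ≡ edgeSum (colourWeight a d) (tabulate c)
eG-partGraph {n} a d c = trans (sumPairs-cong n (λ _ → partGraph-colourWeight a d c _ _)) (eG-tabulate (colourWeight a d) c)

PG-partGraph : ∀ a d {r} (c : Fin n → Fin r) → PG (partGraph a d c) ≡ edgeProd (colourWeight a d) (tabulate c)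
PG-partGraph {n} a d c = trans (prodPairs-cong n (λ _ → partGraph-colourWeight a d c _ _)) (PG-tabulate (colourWeight a d) c)

edgeSum≤SigmaT : ∀ a d {r} (cs : List (Fin r)) → edgeSum (colourWeight a d) cs ≤ SigmaT r d a (length cs)
edgeSum≤SigmaT a d cs = ≤-trans
  (≤-reflexive (sym (trans (eG-partGraph a d (Vec.lookup v)) (cong (edgeSum (colourWeight a d)) (tabulate-fromList cs)))))
  (maxList-upper (∈-map⁺ (λ v → eG (partGraph a d (Vec.lookup v))) (∈-allAssign v)))
  where v = Vec.fromList cs

edgeProd≤PiT : ∀ a d {r} (cs : List (Fin r)) → edgeProd (colourWeight a d) cs ≤ PiT r d a (length cs)
edgeProd≤PiT a d cs = ≤-trans
  (≤-reflexive (sym (trans (PG-partGraph a d (Vec.lookup v)) (cong (edgeProd (colourWeight a d)) (tabulate-fromList cs)))))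
  (maxList-upper (∈-map⁺ (λ v → PG (partGraph a d (Vec.lookup v))) (∈-allAssign v)))
  where v = Vec.fromList cs

SigmaT-attained : ∀ R d a n → ∃ λ (c : Fin n → Fin (suc R)) → SigmaT (suc R) d a n ≡ eG (partGraph a d c)
SigmaT-attained R d a n with maxList-attained _ (∈-allAssign {n} {suc R} (Vec.replicate n zero))
... | v , eq = Vec.lookup v , eq

PiT-attained : ∀ R d a n → ∃ λ (c : Fin n → Fin (suc R)) → PiT (suc R) d a n ≡ PG (partGraph a d c)
PiT-attained R d a n with maxList-attained _ (∈-allAssign {n} {suc R} (Vec.replicate n zero))
... | v , eq = Vec.lookup v , eq

-- Part sizes.

sum-tabulate-≤ : ∀ {n q} (f : Fin n → ℕ) → (∀ i → f i ≤ q) → sum (tabulate f) ≤ n * q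
sum-tabulate-≤ {zero}  f f≤ = z≤n
sum-tabulate-≤ {suc n} f f≤ = +-mono-≤ (f≤ zero) (sum-tabulate-≤ (f ∘ suc) (f≤ ∘ suc))

sum-tabulate-min : ∀ {n} q (f : Fin n → ℕ) → (∃ λ i → f i ≤ q) ⊎ n * q ≤ sum (tabulate f)
sum-tabulate-min {zero}  q f = inj₂ z≤n
sum-tabulate-min {suc n} q f with ≤-total (f zero) q | sum-tabulate-min q (f ∘ suc)
... | inj₁ f≤q | _             = inj₁ (zero , f≤q)
... | inj₂ _   | inj₁ (i , f≤) = inj₁ (suc i , f≤)
... | inj₂ q≤f | inj₂ le       = inj₂ (+-mono-≤ q≤f le)

sum-tabulate-* : ∀ {n} k (f : Fin n → ℕ) → sum (tabulate (λ i → k * f i)) ≡ k * sum (tabulate f)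
sum-tabulate-* {zero}  k f = sym (*-zeroʳ k)
sum-tabulate-* {suc n} k f rewrite sum-tabulate-* k (f ∘ suc) = sym (*-distribˡ-+ k (f zero) _)

sum-tabulate-bump : ∀ {n} (f g : Fin n → ℕ) i → g i ≡ suc (f i) → (∀ j → j ≢ i → g j ≡ f j) →
  sum (tabulate g) ≡ suc (sum (tabulate f))
sum-tabulate-bump f g zero    gi rest =
  cong₂ _+_ gi (cong sum (tabulate-cong (λ j → rest (suc j) λ ())))
sum-tabulate-bump f g (suc i) gi rest = trans
  (cong₂ _+_ (rest zero λ ()) (sum-tabulate-bump (f ∘ suc) (g ∘ suc) i gi (λ j j≢i → rest (suc j) (j≢i ∘ F.suc-injective))))
  (+-suc (f zero) _)

occurrences : ∀ {r} → Fin r → List (Fin r) → ℕ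
occurrences c cs = length (filter (c F.≟_) cs)

occurrences-≡ : ∀ {r} {c : Fin r} {x cs} → c ≡ x → occurrences c (x ∷ cs) ≡ suc (occurrences c cs)
occurrences-≡ {c = c} c≡x = cong length (filter-accept (c F.≟_) c≡x)

occurrences-≢ : ∀ {r} {c : Fin r} {x cs} → c ≢ x → occurrences c (x ∷ cs) ≡ occurrences c cs
occurrences-≢ {c = c} c≢x = cong length (filter-reject (c F.≟_) c≢x)

occurrences-↭ : ∀ {r} (c : Fin r) {cs cs′} → cs ↭ cs′ → occurrences c cs ≡ occurrences c cs′
occurrences-↭ c σ = ↭-length (filter-↭ (c F.≟_) σ)

sum-occurrences : ∀ {r} (cs : List (Fin r)) → sum (tabulate (λ c → occurrences c cs)) ≡ length cs
sum-occurrences {r} []       = sum-zeros r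
sum-occurrences     (x ∷ cs) = trans
  (sum-tabulate-bump (λ c → occurrences c cs) _ x (occurrences-≡ {c = x} {x} {cs} refl)
    (λ c c≢x → occurrences-≢ {cs = cs} c≢x))
  (cong suc (sum-occurrences cs))

occurring-↭ : ∀ {r} (c : Fin r) cs {k} → occurrences c cs ≡ suc k → ∃ λ cs′ → c ∷ cs′ ↭ cs
occurring-↭ c (x ∷ cs) eq with c F.≟ x
... | yes refl = cs , ↭-refl
... | no  c≢x  with occurring-↭ c cs eq
...   | cs′ , σ = x ∷ cs′ , ↭-trans (swap c x ↭-refl) (prep x σ)

-- Degrees in a colouring and the increment of Σ.

module Colouring (R d a : ℕ) (d<a : d < a) where

  W : Fin (suc R) → Fin (suc R) → ℕ
  W = colourWeight a d

  loss : Fin (suc R) → ℕ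
  loss zero    = suc d
  loss (suc _) = 1

  W-spec : ∀ c c′ → (c ≡ c′ × W c c′ + loss c ≡ suc a) ⊎ (c ≢ c′ × W c c′ ≡ suc a)
  W-spec c c′ with c F.≟ c′
  ... | no c≢c′ = inj₂ (c≢c′ , refl)
  W-spec zero    .zero    | yes refl = inj₁ (refl , trans (+-suc (a ∸ d) d) (cong suc (m∸n+n≡m (<⇒≤ d<a))))
  W-spec (suc c) .(suc c) | yes refl = inj₁ (refl , +-comm a 1)

  W-sym : Symm W
  W-sym c c′ with W-spec c c′ | W-spec c′ c
  ... | inj₁ (refl , _) | _                = refl
  ... | inj₂ (c≢ , _)   | inj₁ (c≡ , _)    = contradiction (sym c≡) c≢
  ... | inj₂ (_ , eq)   | inj₂ (_ , eq′)   = trans eq (sym eq′)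

  degSum-W : ∀ c cs → degSum W c cs + loss c * occurrences c cs ≡ length cs * suc a
  degSum-W c [] = *-zeroʳ (loss c)
  degSum-W c (x ∷ cs) with W-spec c x
  ... | inj₁ (c≡x , eq) = begin
    W c x + degSum W c cs + loss c * occurrences c (x ∷ cs)
      ≡⟨ cong (λ t → W c x + degSum W c cs + loss c * t) (occurrences-≡ {cs = cs} c≡x) ⟩
    W c x + degSum W c cs + loss c * suc (occurrences c cs)
      ≡⟨ e₁ (W c x) (degSum W c cs) (loss c) (occurrences c cs) ⟩
    (W c x + loss c) + (degSum W c cs + loss c * occurrences c cs)
      ≡⟨ cong₂ _+_ eq (degSum-W c cs) ⟩
    suc a + length cs * suc a ∎
    where
    open ≡-Reasoning
    e₁ : ∀ w s l k → w + s + l * suc k ≡ (w + l) + (s + l * k)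
    e₁ = solve-∀
  ... | inj₂ (c≢x , eq) = begin
    W c x + degSum W c cs + loss c * occurrences c (x ∷ cs)
      ≡⟨ cong (λ t → W c x + degSum W c cs + loss c * t) (occurrences-≢ {cs = cs} c≢x) ⟩
    W c x + degSum W c cs + loss c * occurrences c cs
      ≡⟨ +-assoc (W c x) _ _ ⟩
    W c x + (degSum W c cs + loss c * occurrences c cs)
      ≡⟨ cong₂ _+_ eq (degSum-W c cs) ⟩
    suc a + length cs * suc a ∎
    where open ≡-Reasoning

  edgeSum-W-≤ : ∀ cs → edgeSum W cs ≤ pairs (length cs) * suc a
  edgeSum-W-≤ []       = z≤n
  edgeSum-W-≤ (c ∷ cs) = begin
    degSum W c cs + edgeSum W cs
      ≤⟨ +-mono-≤ (≤-trans (m≤m+n _ _) (≤-reflexive (degSum-W c cs))) (edgeSum-W-≤ cs) ⟩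
    length cs * suc a + pairs (length cs) * suc a  ≡⟨ *-distribʳ-+ (suc a) (length cs) _ ⟨
    pairs (suc (length cs)) * suc a                ∎
    where open ≤-Reasoning

  Sig Pi : ℕ → ℕ
  Sig = SigmaT (suc R) d a
  Pi  = PiT (suc R) d a

  Sig-attained : ∀ n → ∃ λ cs → length cs ≡ n × Sig n ≡ edgeSum W cs
  Sig-attained n with SigmaT-attained R d a n
  ... | c , eq = tabulate c , length-tabulate c , trans eq (eG-partGraph a d c)

  Pi-attained : ∀ n → ∃ λ cs → length cs ≡ n × Pi n ≡ edgeProd W cs
  Pi-attained n with PiT-attained R d a n
  ... | c , eq = tabulate c , length-tabulate c , trans eq (PG-partGraph a d c)

  Sig-≤ : ∀ n → Sig n ≤ pairs n * suc a
  Sig-≤ n with Sig-attained n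
  ... | cs , refl , eq = ≤-trans (≤-reflexive eq) (edgeSum-W-≤ cs)

  -- Weighted pigeonhole with `n = length cs` and `B = R (d + 1) + 1`: shares of `n / B` for `V_0`
  -- and `(d + 1) n / B` for each of the other `R` parts add up to `n`, so some part stays within
  -- its share.
  cheap-colour : ∀ cs → ∃ λ c → (R * suc d + 1) * (loss c * occurrences c cs) ≤ suc d * length cs
  cheap-colour cs with (R * suc d + 1) * occurrences zero cs ≤? length cs
  ... | yes le = zero , ≤-trans (≤-reflexive (e (R * suc d + 1) (suc d) _)) (*-monoʳ-≤ (suc d) le)
    where
    e : ∀ b c x → b * (c * x) ≡ c * (b * x)
    e = solve-∀
  ... | no ¬le with sum-tabulate-min (suc d * length cs) (λ c → (R * suc d + 1) * (1 * occurrences (suc c) cs))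
  ...   | inj₁ (c , le) = suc c , le
  ...   | inj₂ ge = contradiction (begin
    suc (length cs) + R * (suc d * length cs)  ≤⟨ +-mono-≤ (≰⇒> ¬le) ge ⟩
    B * occurrences zero cs + sum (tabulate (λ c → B * (1 * occurrences (suc c) cs)))
      ≡⟨ cong (λ t → B * occurrences zero cs + sum t)
           (tabulate-cong (λ c → cong (B *_) (*-identityˡ (occurrences (suc c) cs)))) ⟩
    B * occurrences zero cs + sum (tabulate (λ c → B * occurrences (suc c) cs))
      ≡⟨ sum-tabulate-* B (λ c → occurrences c cs) ⟩
    B * sum (tabulate (λ c → occurrences c cs)) ≡⟨ cong (B *_) (sum-occurrences cs) ⟩
    B * length cs                               ≡⟨ e R d (length cs) ⟩
    length cs + R * (suc d * length cs)         ∎) 1+n≰n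
    where
    open ≤-Reasoning
    B : ℕ
    B = R * suc d + 1
    e : ∀ R d m → (R * suc d + 1) * m ≡ m + R * (suc d * m)
    e = solve-∀

  -- The remaining `s` vertices span at most `Sig s`, and the removed one has degree `s (a + 1)`
  -- minus its losses to the vertices of its own colour left in `cs′`.
  removal-≤ : ∀ {cs c cs′} s → length cs ≡ suc s → c ∷ cs′ ↭ cs →
    edgeSum W cs + loss c * occurrences c cs′ ≤ Sig s + s * suc a
  removal-≤ {cs} {c} {cs′} s len σ with refl ← suc-injective (trans (↭-length σ) len) = begin
    edgeSum W cs + loss c * occurrences c cs′
      ≡⟨ cong (_+ loss c * occurrences c cs′) (edgeSum-↭ W-sym σ) ⟨
    degSum W c cs′ + edgeSum W cs′ + loss c * occurrences c cs′
      ≡⟨ e (degSum W c cs′) (edgeSum W cs′) (loss c * occurrences c cs′) ⟩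
    edgeSum W cs′ + (degSum W c cs′ + loss c * occurrences c cs′)
      ≤⟨ +-mono-≤ (edgeSum≤SigmaT a d cs′) (≤-reflexive (degSum-W c cs′)) ⟩
    Sig (length cs′) + length cs′ * suc a ∎
    where
    open ≤-Reasoning
    e : ∀ x y z → x + y + z ≡ y + (x + z)
    e = solve-∀

  -- The deficit g is at least loss c * (x_c - 1) for every part size x_c of an optimal colouring.
  Sig-increment : ∀ s → ∃ λ g → Sig (suc s) + g ≡ Sig s + s * suc a × suc (s * suc d) ≤ (R * suc d + 1) * suc g
  Sig-increment s with Sig-attained (suc s)
  ... | c₀ ∷ cs₀ , len , eq rewrite eq = g , total , (begin
    -- The part sizes add up to `s + 1`. After multiplication by `d + 1`, `V_0` contributes at most
    -- `g + d + 1` and each other part at most `(d + 1) (g + 1)`. With `B = R (d + 1) + 1` the total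
    -- is `B (g + 1) + d`, and cancelling against `(d + 1) (s + 1)` leaves a strict inequality.
    suc (s * suc d)                                  ≤⟨ +-cancelʳ-≤ (suc d) _ _ (begin
      suc (s * suc d) + suc d                          ≡⟨ e₁ s d ⟩
      suc (suc d * suc s)                              ≡⟨ cong (λ t → suc (suc d * t)) (trans (sum-occurrences cs) len) ⟨
      suc (suc d * (occurrences zero cs + rest))       ≡⟨ cong suc (*-distribˡ-+ (suc d) (occurrences zero cs) rest) ⟩
      suc (suc d * occurrences zero cs + suc d * rest) ≤⟨ s≤s (+-mono-≤ (bound zero) (*-monoʳ-≤ (suc d) rest≤)) ⟩
      suc (g + suc d + suc d * (R * (g + 1)))          ≡⟨ e₂ g d R ⟩
      (R * suc d + 1) * suc g + suc d                  ∎) ⟩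
    (R * suc d + 1) * suc g                          ∎)
    where
    open ≤-Reasoning
    cs : List (Fin (suc R))
    cs = c₀ ∷ cs₀
    rest : ℕ
    rest = sum (tabulate (λ c → occurrences (suc c) cs))
    g : ℕ
    g = Sig s + s * suc a ∸ edgeSum W cs
    total : edgeSum W cs + g ≡ Sig s + s * suc a
    total = m+[n∸m]≡n (≤-trans (m≤m+n (edgeSum W cs) (loss c₀ * occurrences c₀ cs₀)) (removal-≤ {cs} s len ↭-refl))
    bound : ∀ c → loss c * occurrences c cs ≤ g + loss c
    bound c with occurrences c cs in occ
    ... | zero  = ≤-trans (≤-reflexive (*-zeroʳ (loss c))) z≤n
    ... | suc k with occurring-↭ c cs occ
    ...   | cs′ , σ = begin
      loss c * suc k     ≡⟨ *-suc (loss c) k ⟩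
      loss c + loss c * k ≤⟨ +-monoʳ-≤ (loss c) (+-cancelˡ-≤ (edgeSum W cs) _ _ (≤-trans
        (subst (λ t → edgeSum W cs + loss c * t ≤ Sig s + s * suc a) occ′ (removal-≤ {cs} s len σ))
        (≤-reflexive (sym total)))) ⟩
      loss c + g         ≡⟨ +-comm (loss c) g ⟩
      g + loss c         ∎
      where
      occ′ : occurrences c cs′ ≡ k
      occ′ = suc-injective (trans (sym (occurrences-≡ {cs = cs′} refl)) (trans (occurrences-↭ c σ) occ))
    rest≤ : rest ≤ R * (g + 1)
    rest≤ = sum-tabulate-≤ _ (λ c → subst (_≤ g + 1) (*-identityˡ _) (bound (suc c)))
    e₁ : ∀ s d → suc (s * suc d) + suc d ≡ suc (suc d * suc s)
    e₁ = solve-∀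
    e₂ : ∀ g d R → suc (g + suc d + suc d * (R * (g + 1))) ≡ (R * suc d + 1) * suc g + suc d
    e₂ = solve-∀

-- Bernoulli inequalities and the cost of pairs inside `V_0`.

pairs-mono : ∀ {m n} → m ≤ n → pairs m ≤ pairs n
pairs-mono z≤n       = z≤n
pairs-mono (s≤s m≤n) = +-mono-≤ m≤n (pairs-mono m≤n)

bernoulli : ∀ a d → a ^ d * (a + d) ≤ a * suc a ^ d
bernoulli a zero    = ≤-reflexive (e a)
  where
  e : ∀ a → 1 * (a + 0) ≡ a * 1
  e = solve-∀
bernoulli a (suc d) = begin
  a * a ^ d * (a + suc d)                       ≤⟨ m≤m+n _ (a ^ d * d) ⟩
  a * a ^ d * (a + suc d) + a ^ d * d           ≡⟨ e₁ a (a ^ d) d ⟩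
  suc a * (a ^ d * (a + d))                     ≤⟨ *-monoʳ-≤ (suc a) (bernoulli a d) ⟩
  suc a * (a * suc a ^ d)                       ≡⟨ e₂ (suc a) a (suc a ^ d) ⟩
  a * (suc a * suc a ^ d)                       ∎
  where
  open ≤-Reasoning
  e₁ : ∀ a b d → a * b * (a + suc d) + b * d ≡ suc a * (b * (a + d))
  e₁ = solve-∀
  e₂ : ∀ x y z → x * (y * z) ≡ y * (x * z)
  e₂ = solve-∀

-- With `y = x + δ` this is `(1 - δ/y)^k ≥ 1 - k δ/y` multiplied by `y^(k+1)`, the negative term
-- being moved across.
bernoulli-sub : ∀ x δ k → (x + δ) * (x + δ) ^ k ≤ x ^ k * (x + δ) + k * δ * (x + δ) ^ k
bernoulli-sub x δ zero    = ≤-reflexive (e (x + δ))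
  where
  e : ∀ y → y * 1 ≡ 1 * y + 0
  e = solve-∀
bernoulli-sub x δ (suc k) = begin
  y * (y * y ^ k)                                        ≤⟨ *-monoʳ-≤ y (bernoulli-sub x δ k) ⟩
  y * (x ^ k * y + k * δ * y ^ k)                        ≡⟨ e₁ x δ (x ^ k) (k * δ) (y ^ k) ⟩
  x * x ^ k * y + (δ * (x ^ k * y) + k * δ * (y * y ^ k))
    ≤⟨ +-monoʳ-≤ (x * x ^ k * y) (+-monoˡ-≤ _ (*-monoʳ-≤ δ (*-monoˡ-≤ y (^-monoˡ-≤ k (m≤m+n x δ))))) ⟩
  x * x ^ k * y + (δ * (y ^ k * y) + k * δ * (y * y ^ k)) ≡⟨ e₂ (x * x ^ k * y) δ (y ^ k) y k ⟩
  x * x ^ k * y + suc k * δ * (y * y ^ k)                ∎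
  where
  open ≤-Reasoning
  y : ℕ
  y = x + δ
  e₁ : ∀ x δ u v t → (x + δ) * (u * (x + δ) + v * t) ≡ x * u * (x + δ) + (δ * (u * (x + δ)) + v * ((x + δ) * t))
  e₁ = solve-∀
  e₂ : ∀ x δ t y k → x + (δ * (t * y) + k * δ * (y * t)) ≡ x + suc k * δ * (y * t)
  e₂ = solve-∀

-- Up to second order in 1/a, replacing a+1 by a-d costs d+1 times as much as replacing it by a.
heavy-loss : ∀ a b d Q .{{_ : NonZero a}} → b + d ≡ a → Q * (d * d) * suc a ≤ a * a →
  a * (a * a ^ d) ^ Q ≤ suc a * (b * suc a ^ d) ^ Q
heavy-loss a b d Q b+d≡a large = *-cancelˡ-≤ (y ^ Q) {{m^n≢0 y Q {{nz}}}} (begin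
  y ^ Q * (a * v ^ Q)      ≡⟨ e₁ (y ^ Q) a (v ^ Q) ⟩
  a * y ^ Q * v ^ Q        ≤⟨ *-monoˡ-≤ (v ^ Q) ratio ⟩
  p * x ^ Q * v ^ Q        ≡⟨ *-assoc p (x ^ Q) (v ^ Q) ⟩
  p * (x ^ Q * v ^ Q)      ≡⟨ cong (p *_) (^-distribʳ-* x v Q) ⟨
  p * (x * v) ^ Q          ≤⟨ *-monoʳ-≤ p (^-monoˡ-≤ Q xv≤yu) ⟩
  p * (y * u) ^ Q          ≡⟨ cong (p *_) (^-distribʳ-* y u Q) ⟩
  p * (y ^ Q * u ^ Q)      ≡⟨ e₂ p (y ^ Q) (u ^ Q) ⟩
  y ^ Q * (p * u ^ Q)      ∎)
  where
  open ≤-Reasoning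
  p u v x y : ℕ
  p = suc a
  u = b * suc a ^ d
  v = a * a ^ d
  x = b * (a + d)
  y = a * a
  nz : NonZero y
  nz = m*n≢0 a a
  e₁ : ∀ x y z → x * (y * z) ≡ y * x * z
  e₁ = solve-∀
  e₂ : ∀ x y z → x * (y * z) ≡ y * (x * z)
  e₂ = solve-∀
  x+δ≡y : x + d * d ≡ y
  x+δ≡y rewrite sym b+d≡a = e b d
    where
    e : ∀ b d → b * (b + d + d) + d * d ≡ (b + d) * (b + d)
    e = solve-∀
  xv≤yu : x * v ≤ y * u
  xv≤yu = begin
    x * v                          ≡⟨ e₃ b (a + d) a (a ^ d) ⟩
    a * b * (a ^ d * (a + d))      ≤⟨ *-monoʳ-≤ (a * b) (bernoulli a d) ⟩
    a * b * (a * suc a ^ d)        ≡⟨ e₄ a b (suc a ^ d) ⟩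
    y * u                          ∎
    where
    e₃ : ∀ b c a t → b * c * (a * t) ≡ a * b * (t * c)
    e₃ = solve-∀
    e₄ : ∀ a b t → a * b * (a * t) ≡ a * a * (b * t)
    e₄ = solve-∀
  -- As `x / y = 1 - d²/a²`, `bernoulli-sub` bounds the drop of its `Q`-th power by `Q d²/a²`, which
  -- `large` makes at most `1/(a + 1)`.
  ratio : a * y ^ Q ≤ p * x ^ Q
  ratio = *-cancelˡ-≤ y {{nz}} (+-cancelʳ-≤ (y * y ^ Q) _ _ (begin
    y * (a * y ^ Q) + y * y ^ Q             ≡⟨ e₅ y a (y ^ Q) ⟩
    p * (y * y ^ Q)                         ≤⟨ *-monoʳ-≤ p (subst
      (λ y → y * y ^ Q ≤ x ^ Q * y + Q * (d * d) * y ^ Q) x+δ≡y (bernoulli-sub x (d * d) Q)) ⟩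
    p * (x ^ Q * y + Q * (d * d) * y ^ Q)   ≡⟨ e₆ p (x ^ Q) y (Q * (d * d)) (y ^ Q) ⟩
    y * (p * x ^ Q) + Q * (d * d) * p * y ^ Q ≤⟨ +-monoʳ-≤ _ (*-monoˡ-≤ (y ^ Q) large) ⟩
    y * (p * x ^ Q) + y * y ^ Q             ∎))
    where
    e₅ : ∀ y a t → y * (a * t) + y * t ≡ suc a * (y * t)
    e₅ = solve-∀
    e₆ : ∀ p x y q t → p * (x * y + q * t) ≡ y * (p * x) + q * p * t
    e₆ = solve-∀

-- Growth of Π when vertices are added.

module Growth (R d s a : ℕ) (d<a : d < a) (large : suc s * (d * d) * suc a ≤ a * a) where

  instance
    a≢0 : NonZero a
    a≢0 = >-nonZero (≤-<-trans z≤n d<a)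

  open Ratio a
  open Colouring R d a d<a

  -- The `Q`-th power turns the cost ρ^(d+1+1/Q) of a pair inside `V_0` into the integral power `κ`;
  -- the summand 1/Q absorbs the second-order error in `heavy-loss`. `B` is the denominator of the
  -- shares in `cheap-colour`, and `E` clears both denominators.
  Q B E κ : ℕ
  Q = suc s
  B = R * suc d + 1
  E = Q * B
  κ = Q * suc d + 1

  unitCost : Fin (suc R) → ℕ
  unitCost zero    = κ
  unitCost (suc _) = Q

  W-diag-≼ : ∀ c → p ^ Q ≼ W c c ^ Q ρ[ unitCost c - 0 ]
  W-diag-≼ zero = mk (begin
    p ^ Q * (1 * a ^ κ)                       ≡⟨ cong (p ^ Q *_) (trans (*-identityˡ (a ^ κ)) (split a)) ⟩
    p ^ Q * (a * (a * a ^ d) ^ Q)             ≤⟨ *-monoʳ-≤ (p ^ Q) (heavy-loss a (a ∸ d) d Q (m∸n+n≡m (<⇒≤ d<a)) large) ⟩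
    p ^ Q * (p * ((a ∸ d) * p ^ d) ^ Q)       ≡⟨ cong (λ t → p ^ Q * (p * t)) (^-distribʳ-* (a ∸ d) (p ^ d) Q) ⟩
    p ^ Q * (p * ((a ∸ d) ^ Q * (p ^ d) ^ Q)) ≡⟨ e (p ^ Q) p ((a ∸ d) ^ Q) ((p ^ d) ^ Q) ⟩
    (a ∸ d) ^ Q * (p * (p ^ Q * (p ^ d) ^ Q)) ≡⟨ cong (λ t → (a ∸ d) ^ Q * (p * t)) (^-distribʳ-* p (p ^ d) Q) ⟨
    (a ∸ d) ^ Q * (p * (p * p ^ d) ^ Q)       ≡⟨ cong ((a ∸ d) ^ Q *_) (trans (*-identityʳ (p ^ κ)) (split p)) ⟨
    (a ∸ d) ^ Q * (p ^ κ * 1)                 ∎)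
    where
    open ≤-Reasoning
    split : ∀ x → x ^ κ ≡ x * (x * x ^ d) ^ Q
    split x = trans (cong (x ^_) (+-comm (Q * suc d) 1))
      (cong (x *_) (trans (cong (x ^_) (*-comm Q (suc d))) (sym (^-*-assoc x (suc d) Q))))
    e : ∀ x y z t → x * (y * (z * t)) ≡ z * (y * (x * t))
    e = solve-∀
  W-diag-≼ (suc c) with W-spec (suc c) (suc c)
  ... | inj₂ (c≢c , _) = contradiction refl c≢c
  ... | inj₁ (_ , eq) rewrite suc-injective (trans (+-comm 1 (W (suc c) (suc c))) eq) =
    ≼-weaken (≤-reflexive (e₀ Q)) (≼-^ Q (mk {p} {a} {1} {0} (≤-reflexive (e p a))))
    where
    e₀ : ∀ q → q * 1 + 0 ≡ q + q * 0
    e₀ = solve-∀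
    e : ∀ p a → p * (1 * (a * 1)) ≡ a * (p * 1 * 1)
    e = solve-∀

  degProd-W-≼ : ∀ c cs → (p ^ length cs) ^ Q ≼ degProd W c cs ^ Q ρ[ unitCost c * occurrences c cs - 0 ]
  degProd-W-≼ c [] = ≼-weaken z≤n (≼-≤ ≤-refl)
  degProd-W-≼ c (x ∷ cs)
    rewrite ^-distribʳ-* p (p ^ length cs) Q | ^-distribʳ-* (W c x) (degProd W c cs) Q with W-spec c x
  ... | inj₁ (refl , _) = ≼-weaken
    (≤-reflexive (cong (_+ 0) (sym (trans
      (cong (unitCost c *_) (occurrences-≡ {c = c} {cs = cs} refl)) (*-suc (unitCost c) _)))))
    (≼-* (W-diag-≼ c) (degProd-W-≼ c cs))
  ... | inj₂ (c≢x , eq) rewrite eq = ≼-weaken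
    (≤-reflexive (cong (λ t → unitCost c * t + 0) (sym (occurrences-≢ {cs = cs} c≢x))))
    (≼-* (≼-≤ (≤-refl {p ^ Q})) (degProd-W-≼ c cs))

  -- The colour from `cheap-colour` suits these costs too: for `V_0` the factor `d + 1` cancels and
  -- `κ` is put in its place; elsewhere `Q (d + 1) ≤ κ`.
  cheap-cost : ∀ cs → ∃ λ c → B * (unitCost c * occurrences c cs) ≤ κ * length cs
  cheap-cost cs with cheap-colour cs
  ... | zero , le = zero , ≤-trans (≤-reflexive (e B κ _))
    (*-monoʳ-≤ κ (*-cancelˡ-≤ (suc d) (≤-trans (≤-reflexive (e (suc d) B _)) le)))
    where
    e : ∀ b c x → b * (c * x) ≡ c * (b * x)
    e = solve-∀
  ... | suc c , le = suc c , (begin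
    B * (Q * occurrences (suc c) cs)        ≡⟨ e B Q _ ⟩
    Q * (B * (1 * occurrences (suc c) cs))  ≤⟨ *-monoʳ-≤ Q le ⟩
    Q * (suc d * length cs)                 ≡⟨ *-assoc Q (suc d) _ ⟨
    Q * suc d * length cs                   ≤⟨ *-monoˡ-≤ (length cs) (m≤m+n (Q * suc d) 1) ⟩
    κ * length cs                           ∎)
    where
    open ≤-Reasoning
    e : ∀ b c x → b * (c * x) ≡ c * (b * (1 * x))
    e = solve-∀

  -- A vertex of a cheap colour joins an optimal colouring of `m` vertices; in `E`-th powers its
  -- degree product is within ρ^(κ m) of the full `p ^ m`.
  Pi-step : ∀ m → Pi m ^ E * (p ^ m) ^ E ≼ Pi (suc m) ^ E ρ[ κ * m - 0 ]
  Pi-step m with Pi-attained m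
  ... | cs , refl , eq rewrite eq with cheap-cost cs
  ...   | c , le = ≼-weaken exponents
    (≼-trans (≼-* (≼-≤ (≤-refl {edgeProd W cs ^ E})) newVertex)
      (≼-≤ (begin
        edgeProd W cs ^ E * degProd W c cs ^ E   ≡⟨ *-comm (edgeProd W cs ^ E) _ ⟩
        degProd W c cs ^ E * edgeProd W cs ^ E   ≡⟨ ^-distribʳ-* (degProd W c cs) (edgeProd W cs) E ⟨
        edgeProd W (c ∷ cs) ^ E                  ≤⟨ ^-monoˡ-≤ E (edgeProd≤PiT a d (c ∷ cs)) ⟩
        Pi (suc (length cs)) ^ E                 ∎)))
    where
    open ≤-Reasoning
    newVertex : (p ^ length cs) ^ E ≼ degProd W c cs ^ E ρ[ B * (unitCost c * occurrences c cs) - B * 0 ]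
    newVertex = subst₂ (λ x y → x ≼ y ρ[ B * (unitCost c * occurrences c cs) - B * 0 ])
      (^-*-assoc (p ^ length cs) Q B) (^-*-assoc (degProd W c cs) Q B) (≼-^ B (degProd-W-≼ c cs))
    exponents : B * (unitCost c * occurrences c cs) + 0 + 0 ≤ κ * length cs + (B * 0 + 0)
    exponents = begin
      B * (unitCost c * occurrences c cs) + 0 + 0  ≡⟨ trans (+-identityʳ _) (+-identityʳ _) ⟩
      B * (unitCost c * occurrences c cs)          ≤⟨ le ⟩
      κ * length cs                                ≤⟨ m≤m+n _ _ ⟩
      κ * length cs + (B * 0 + 0)                  ∎

  Pi-steps : ∀ m n → Pi m ^ E * (p ^ (pairs n + n * m)) ^ E ≼ Pi (n + m) ^ E ρ[ κ * (pairs n + n * m) - 0 ]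
  Pi-steps m zero = ≼-weaken z≤n (≼-≤ (≤-reflexive (trans (cong (Pi m ^ E *_) (^-zeroˡ E)) (*-identityʳ _))))
  Pi-steps m (suc n) = subst (λ t → Pi m ^ E * (p ^ t) ^ E ≼ Pi (suc n + m) ^ E ρ[ κ * t - 0 ]) (e₁ (pairs n) n m)
    (≼-weaken (≤-reflexive (e₂ κ (pairs n + n * m) (n + m)))
      (≼-trans (≼-≤ (≤-reflexive e₃))
        (≼-trans (≼-* (Pi-steps m n) (≼-≤ (≤-refl {(p ^ (n + m)) ^ E}))) (Pi-step (n + m)))))
    where
    e₁ : ∀ q n m → q + n * m + (n + m) ≡ n + q + suc n * m
    e₁ = solve-∀
    e₂ : ∀ k x y → 0 + (k * x + 0 + k * y) + 0 ≡ k * (x + y) + (0 + (0 + 0))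
    e₂ = solve-∀
    e₃ : Pi m ^ E * (p ^ (pairs n + n * m + (n + m))) ^ E ≡ Pi m ^ E * (p ^ (pairs n + n * m)) ^ E * (p ^ (n + m)) ^ E
    e₃ = trans (cong (λ t → Pi m ^ E * t ^ E) (^-distribˡ-+-* p (pairs n + n * m) (n + m)))
      (trans (cong (Pi m ^ E *_) (^-distribʳ-* (p ^ (pairs n + n * m)) (p ^ (n + m)) E)) (sym (*-assoc (Pi m ^ E) _ _)))

  complete-≼ : ∀ n → (p ^ pairs n) ^ E ≼ Pi n ^ E ρ[ κ * pairs n - 0 ]
  complete-≼ n = ≼-trans (≼-≤ (≤-reflexive (sym (trans (cong (_* (p ^ pairs n) ^ E) (^-zeroˡ E)) (*-identityˡ _)))))
    (subst₂ (λ t u → Pi 0 ^ E * (p ^ t) ^ E ≼ Pi u ^ E ρ[ κ * t - 0 ])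
      (trans (cong (pairs n +_) (*-zeroʳ n)) (+-identityʳ _)) (+-identityʳ n) (Pi-steps 0 n))

-- Deletion of dense `s`-sets.

module Descent (R d s a : ℕ) (d<a : d < a) (large : suc s * (d * d) * suc a ≤ a * a)
  {A : Set} (w : A → A → ℕ) (w-sym : Symm w) where

  open Growth R d s a d<a large
  open Ratio a
  open Colouring R d a d<a

  record Dense (l : List A) : Set where
    constructor dense
    field
      X Z   : List A
      split : X ++ Z ↭ l
      size  : length X ≡ s
      heavy : Sig s < edgeSum w X

  -- The bound for `s + 1` vertices is applied to `v ∷ X`. As `X` already spans `t + 1` edges beyond
  -- `Sig s`, this excess comes off the degree of `v`, on top of `g`.
  sparse-outside : ∀ {l X Z v g t} → Bounded w (suc s) (Sig (suc s)) l → X ++ Z ↭ l → length X ≡ s →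
    Sig (suc s) + g ≡ Sig s + s * p → suc (Sig s) + t ≡ edgeSum w X → v ∈ Z →
    degSum w v X + (g + suc t) ≤ s * p
  sparse-outside {X = X} {v = v} {g} {t} b σ len eq-g eq-t v∈Z with ∈-∃++ v∈Z
  ... | as , bs , refl = +-cancelʳ-≤ (Sig s) _ _ (begin
    degSum w v X + (g + suc t) + Sig s      ≡⟨ e (degSum w v X) g t (Sig s) ⟩
    degSum w v X + (suc (Sig s) + t) + g    ≡⟨ cong (λ x → degSum w v X + x + g) eq-t ⟩
    edgeSum w (v ∷ X) + g                   ≤⟨ +-monoˡ-≤ g (b (v ∷ X) (as ++ bs) τ (cong suc len)) ⟩
    Sig (suc s) + g                         ≡⟨ eq-g ⟩
    Sig s + s * p                           ≡⟨ +-comm (Sig s) _ ⟩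
    s * p + Sig s                           ∎)
    where
    open ≤-Reasoning
    e : ∀ x g t y → x + (g + suc t) + y ≡ x + (suc y + t) + g
    e = solve-∀
    τ : (v ∷ X) ++ as ++ bs ↭ _
    τ = ↭-trans (↭-sym (shift v X (as ++ bs))) (↭-trans (Perm.++⁺ˡ X (↭-sym (shift v as bs))) σ)

  -- Let `t + 1` be the excess of `X` over `Sig s`. Each outside vertex has degree product at most
  -- ρ^(-(g+t+1)) times `p ^ s` into `X`, and the pairs inside `X` contribute at most ρ^(t+1) times
  -- `p ^ pairs s`.
  remove-dense : ∀ {l g} → Bounded w (suc s) (Sig (suc s)) l → Sig (suc s) + g ≡ Sig s + s * p →
    (D : Dense l) → let open Dense D in 1 ≤ length Z →
    edgeProd w l ≼ edgeProd w Z * p ^ (pairs s + s * length Z) ρ[ 1 - length Z * suc g ]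
  remove-dense {l} {g} b eq-g (dense X Z σ len heavy) 1≤m with m≤n⇒∃[o]m+o≡n heavy
  ... | t , eq-t = ≼-trans (≼-≤ (≤-reflexive factor))
    (≼-weaken exponents
      (≼-trans (≼-* (≼-≤ (≤-refl {edgeProd w Z})) (≼-* outer inner)) (≼-≤ (≤-reflexive (cong (edgeProd w Z *_) powers)))))
    where
    open ≤-Reasoning
    m : ℕ
    m = length Z
    factor : edgeProd w l ≡ edgeProd w Z * (product (map (λ z → degProd w z X) Z) * edgeProd w X)
    factor = trans (edgeProd-↭ w-sym (↭-trans (↭-sym σ) (Perm.++-comm X Z))) (edgeProd-++ w Z X)
    outer : product (map (λ z → degProd w z X) Z) ≼ (p ^ s) ^ m ρ[ m * 0 - m * (g + suc t) ]
    outer = products-≼ _ Z (All.tabulate λ {v} v∈Z → ≼-weaken (sparse-outside b σ len eq-g eq-t v∈Z)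
      (subst (λ k → degProd w v X ≼ p ^ k ρ[ degSum w v X - k * p ]) len (degProd-≼ w v X)))
    inner : edgeProd w X ≼ p ^ pairs s ρ[ suc t - 0 ]
    inner = ≼-weaken (begin
      edgeSum w X + 0          ≡⟨ +-identityʳ _ ⟩
      edgeSum w X              ≡⟨ eq-t ⟨
      suc (Sig s) + t          ≡⟨ cong suc (+-comm (Sig s) t) ⟩
      suc t + Sig s            ≤⟨ +-monoʳ-≤ (suc t) (Sig-≤ s) ⟩
      suc t + pairs s * p      ∎)
      (subst (λ k → edgeProd w X ≼ p ^ pairs k ρ[ edgeSum w X - pairs k * p ]) len (edgeProd-≼ w X))
    powers : (p ^ s) ^ m * p ^ pairs s ≡ p ^ (pairs s + s * m)
    powers = trans (cong (_* p ^ pairs s) (^-*-assoc p s m))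
      (trans (*-comm (p ^ (s * m)) _) (sym (^-distribˡ-+-* p (pairs s) (s * m))))
    -- (m - 1) t ≥ 0: the excess t + 1 of X is lost again at each of the m outside vertices.
    exponents : 0 + (m * 0 + suc t) + 0 + m * suc g ≤ 1 + (0 + (m * (g + suc t) + 0) + 0)
    exponents = begin
      0 + (m * 0 + suc t) + 0 + m * suc g     ≡⟨ e₁ m t g ⟩
      suc (m * suc g + 1 * t)                 ≤⟨ s≤s (+-monoʳ-≤ (m * suc g) (*-monoˡ-≤ t 1≤m)) ⟩
      suc (m * suc g + m * t)                 ≡⟨ e₂ m t g ⟩
      1 + (0 + (m * (g + suc t) + 0) + 0)     ∎
      where
      e₁ : ∀ m t g → 0 + (m * 0 + suc t) + 0 + m * suc g ≡ suc (m * suc g + 1 * t)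
      e₁ = solve-∀
      e₂ : ∀ m t g → suc (m * suc g + m * t) ≡ 1 + (0 + (m * (g + suc t) + 0) + 0)
      e₂ = solve-∀

  -- Deletion and regrowth of Π involve the same power of `p`, so only exponents of ρ remain, and
  -- `gap` leaves a surplus of `length Z` among them. It is spent with `K′ = K` to iterate and with
  -- `K′ = 0` to finish.
  descend : ∀ {l K K′} → Bounded w (suc s) (Sig (suc s)) l →
    (D : Dense l) → let open Dense D in 1 ≤ length Z →
    K + κ * pairs s + E ≤ K′ + length Z →
    edgeProd w Z ^ E ≼ Pi (length Z) ^ E ρ[ K - 0 ] →
    edgeProd w l ^ E ≼ Pi (length l) ^ E ρ[ K′ - 0 ]
  descend {l} {K} {K′} b D 1≤m gain rec with Sig-increment s
  ... | g , eq-g , gap = ≼-weaken exponents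
    (≼-trans (≼-^ E (remove-dense b eq-g D 1≤m))
    (≼-trans (≼-≤ (≤-reflexive (^-distribʳ-* (edgeProd w Z) (p ^ P) E)))
    (≼-trans (≼-* rec (≼-≤ (≤-refl {(p ^ P) ^ E})))
      (subst (λ k → Pi m ^ E * (p ^ P) ^ E ≼ Pi k ^ E ρ[ κ * P - 0 ]) size-l (Pi-steps m s)))))
    where
    open ≤-Reasoning
    open Dense D
    m P : ℕ
    m = length Z
    P = pairs s + s * m
    size-l : s + m ≡ length l
    size-l = trans (cong (_+ m) (sym size)) (trans (sym (length-++ X)) (↭-length split))
    -- Q = s + 1 makes κ s m + m equal to Q m (s (d + 1) + 1).
    exponents : E * 1 + (0 + (K + 0 + κ * P)) + 0 ≤ K′ + (E * (m * suc g) + 0)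
    exponents = begin
      E * 1 + (0 + (K + 0 + κ * P)) + 0           ≡⟨ e₁ E K κ (pairs s) (s * m) ⟩
      K + κ * pairs s + E + κ * (s * m)           ≤⟨ +-monoˡ-≤ (κ * (s * m)) gain ⟩
      K′ + m + κ * (s * m)                        ≡⟨ e₂ K′ m s d ⟩
      K′ + Q * m * suc (s * suc d)                ≤⟨ +-monoʳ-≤ K′ (*-monoʳ-≤ (Q * m) gap) ⟩
      K′ + Q * m * (B * suc g)                    ≡⟨ e₃ K′ Q m B (suc g) ⟩
      K′ + (E * (m * suc g) + 0)                  ∎
      where
      e₁ : ∀ E K k x y → E * 1 + (0 + (K + 0 + k * (x + y))) + 0 ≡ K + k * x + E + k * y
      e₁ = solve-∀
      e₂ : ∀ K m s d → K + m + (suc s * suc d + 1) * (s * m) ≡ K + suc s * m * suc (s * suc d)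
      e₂ = solve-∀
      e₃ : ∀ K q m b g → K + q * m * (b * g) ≡ K + (q * b * (m * g) + 0)
      e₃ = solve-∀

  -- Averaging gives the bound `p ^ pairs (length l)`, which exceeds Π by at most the factor in
  -- `complete-≼`. The exponent does not involve `a`, so it stays bounded for bounded length.
  small-bound : ∀ l → 1 ≤ s → suc s ≤ length l → Bounded w (suc s) (Sig (suc s)) l →
    edgeProd w l ^ E ≼ Pi (length l) ^ E ρ[ κ * pairs (length l) - 0 ]
  small-bound l 1≤s s<n b = ≼-weaken exponents
    (≼-trans (≼-^ E (≼-weaken (≤-trans (≤-reflexive (+-identityʳ _)) (average 1≤s s<n b)) (edgeProd-≼ w l)))
      (complete-≼ (length l)))
    where
    average : 1 ≤ s → suc s ≤ length l → Bounded w (suc s) (Sig (suc s)) l → edgeSum w l ≤ pairs (length l) * p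
    average (s≤s {n = k} _) s<n b = edgeSum-average w k p (length l ∸ suc (suc k)) l (sym (m∸n+n≡m s<n))
      (λ ys zs σ len → ≤-trans (b ys zs σ len) (Sig-≤ (suc (suc k))))
    exponents : E * 0 + κ * pairs (length l) + 0 ≤ κ * pairs (length l) + (E * 0 + 0)
    exponents = ≤-reflexive (e E (κ * pairs (length l)))
      where
      e : ∀ x y → x * 0 + y + 0 ≡ y + (x * 0 + 0)
      e = solve-∀

  module Threshold (n₀ : ℕ) (1≤s : 1 ≤ s)
    (dichotomy : ∀ l → n₀ ≤ length l → edgeProd w l ≤ Pi (length l) ⊎ Dense l) where

    -- `M` outside vertices pay for one deletion and still number at least `s + 1`. A list of at
    -- least `N` vertices is subject to the dichotomy and keeps `M` of them after losing an `s`-set.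
    -- `K` is the error of `small-bound` at length `N`.
    M N K : ℕ
    M = κ * pairs s + E + suc s
    N = n₀ + M + s
    K = κ * pairs N

    remainder : ∀ {l x} (D : Dense l) → x + s ≤ length l → x ≤ length (Dense.Z D)
    remainder {l} {x} (dense X Z σ len _) le = +-cancelʳ-≤ s _ _ (≤-trans le (≤-reflexive
      (trans (sym (↭-length σ)) (trans (length-++ X) (trans (+-comm (length X) _) (cong (length Z +_) len))))))

    -- Strong induction on the length. Up to `N` vertices `small-bound` applies; beyond that a
    -- deletion pays for itself, so the error never rises above `K`.
    rough-bound : ∀ n l → length l ≡ n → suc s ≤ n → Bounded w (suc s) (Sig (suc s)) l →
      edgeProd w l ^ E ≼ Pi (length l) ^ E ρ[ K - 0 ]
    rough-bound = <-rec _ go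
      where
      go : ∀ n → (∀ {m} → m < n → ∀ l → length l ≡ m → suc s ≤ m → Bounded w (suc s) (Sig (suc s)) l →
          edgeProd w l ^ E ≼ Pi (length l) ^ E ρ[ K - 0 ]) →
        ∀ l → length l ≡ n → suc s ≤ n → Bounded w (suc s) (Sig (suc s)) l →
        edgeProd w l ^ E ≼ Pi (length l) ^ E ρ[ K - 0 ]
      go n rec l refl s<n b with ≤-total n N
      ... | inj₁ n≤N = ≼-weaken (+-monoˡ-≤ 0 (*-monoʳ-≤ κ (pairs-mono n≤N))) (small-bound l 1≤s s<n b)
      ... | inj₂ N≤n with dichotomy l (≤-trans (≤-trans (m≤m+n n₀ M) (m≤m+n _ s)) N≤n)
      ...   | inj₁ le = ≼-weaken z≤n (≼-≤ (^-monoˡ-≤ E le))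
      ...   | inj₂ D  = descend {K = K} b D (≤-trans (s≤s z≤n) s<m) gain
        (rec m<n Z refl s<m (Bounded-part (↭-trans (Perm.++-comm Z X) split) b))
        where
        open Dense D
        M≤m : M ≤ length Z
        M≤m = remainder D (≤-trans (+-monoˡ-≤ s (m≤n+m M n₀)) N≤n)
        s<m : suc s ≤ length Z
        s<m = ≤-trans (m≤n+m (suc s) (κ * pairs s + E)) M≤m
        m<n : length Z < length l
        m<n = subst (length Z <_) (trans (cong (_+ length Z) (sym size)) (trans (sym (length-++ X)) (↭-length split)))
          (+-monoˡ-≤ (length Z) 1≤s)
        gain : K + κ * pairs s + E ≤ K + length Z
        gain = ≤-trans (≤-reflexive (+-assoc K _ E)) (+-monoʳ-≤ K (≤-trans (m≤m+n _ (suc s)) M≤m))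

    -- With `K` further vertices, one deletion leaves `M + K` outside, whose surplus also cancels
    -- the error `K` of the remainder. No power of ρ is left and the `E`-th root can be taken.
    sharp-bound : ∀ l → N + K ≤ length l → Bounded w (suc s) (Sig (suc s)) l → edgeProd w l ≤ Pi (length l)
    sharp-bound l large-l b with dichotomy l (≤-trans (≤-trans (≤-trans (m≤m+n n₀ M) (m≤m+n _ s)) (m≤m+n N K)) large-l)
    ... | inj₁ le = le
    ... | inj₂ D  = ^-cancel-≤ E {{m*n≢0 Q B {{_}} {{>-nonZero (m≤n+m 1 (R * suc d))}}}} (≼⇒≤
      (descend {K = K} {0} b D (≤-trans (s≤s z≤n) s<m) gain
        (rough-bound _ Z refl s<m (Bounded-part (↭-trans (Perm.++-comm Z X) split) b))))
      where
      open Dense D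
      M+K≤m : M + K ≤ length Z
      M+K≤m = remainder D (≤-trans (≤-trans (m≤n+m (M + K + s) n₀) (≤-reflexive (e n₀ M K s))) large-l)
        where
        e : ∀ n M K s → n + (M + K + s) ≡ n + M + s + K
        e = solve-∀
      s<m : suc s ≤ length Z
      s<m = ≤-trans (≤-trans (m≤n+m (suc s) (κ * pairs s + E)) (m≤m+n M K)) M+K≤m
      gain : K + κ * pairs s + E ≤ 0 + length Z
      gain = ≤-trans (≤-trans (m≤m+n _ (suc s)) (≤-reflexive (e K (κ * pairs s) E (suc s)))) M+K≤m
        where
        e : ∀ K x E s → K + x + E + s ≡ x + E + s + K
        e = solve-∀

theorem3p11 : (r d s : ℕ) → 1 ≤ r → 1 ≤ d → s ≥ (r ∸ 1) * (d + 1) + 2 →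
    (a₀ n₀ : ℕ) →
    ((a n : ℕ) → a ≥ a₀ → d < a → n ≥ n₀ →
    ExPiEq n s (SigmaT r d a s) (PiT r d a n)) →
    Σ ℕ (λ a₁ → Σ ℕ (λ n₁ → a₁ ≥ a₀ × n₁ ≥ n₀ ×
    ((a n : ℕ) → a ≥ a₁ → d < a → n ≥ n₁ →
    ExPiEq n (suc s) (SigmaT r d a (suc s)) (PiT r d a n))))
theorem3p11 (suc R) d s 1≤r 1≤d s≥ a₀ n₀ hyp =
  -- The summand `2 (s + 1) d²` ensures `(s + 1) d² (a + 1) ≤ 2 (s + 1) d² a ≤ a²`, as `heavy-loss`
  -- requires.
  a₀ + 2 * (suc s * (d * d)) , N + K , m≤m+n a₀ _ , ≤-trans (≤-trans (m≤m+n n₀ M) (m≤m+n _ s)) (m≤m+n N K) ,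
  λ a n a≥ d<a n≥ → lower a n , upper a n a≥ d<a n≥
  where
  -- The values from `Threshold`, written out because that module depends on `a`, whereas the
  -- threshold for `n` is fixed before `a`.
  M N K : ℕ
  M = (suc s * suc d + 1) * pairs s + suc s * (R * suc d + 1) + suc s
  N = n₀ + M + s
  K = (suc s * suc d + 1) * pairs N

  1≤s : 1 ≤ s
  1≤s = ≤-trans (≤-trans (s≤s z≤n) (m≤n+m 2 (R * (d + 1)))) s≥

  -- Any `s + 1` vertices of a coloured graph again carry a coloured graph, so a maximiser for Π is
  -- itself feasible.
  lower : ∀ a n → Σ (Multigraph n) (λ w → InF n (suc s) (SigmaT (suc R) d a (suc s)) w × PG w ≡ PiT (suc R) d a n)
  lower a n with PiT-attained R d a n
  ... | c , eq = partGraph a d c , inF , sym eq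
    where
    inF : InF n (suc s) (SigmaT (suc R) d a (suc s)) (partGraph a d c)
    inF X size = begin
      eIn (partGraph a d c) X                        ≡⟨ eIn-cong (λ _ → partGraph-colourWeight a d c _ _) X ⟩
      eIn (λ i j → colourWeight a d (c i) (c j)) X   ≡⟨ eIn-select (colourWeight a d) c X ⟩
      edgeSum (colourWeight a d) (select X c)        ≤⟨ edgeSum≤SigmaT a d (select X c) ⟩
      SigmaT (suc R) d a (length (select X c))       ≡⟨ cong (SigmaT (suc R) d a) (trans (length-select X c) size) ⟩
      SigmaT (suc R) d a (suc s)                     ∎
      where open ≤-Reasoning

  large : ∀ {a} → a ≥ a₀ + 2 * (suc s * (d * d)) → d < a → suc s * (d * d) * suc a ≤ a * a
  large {a} a≥ d<a = begin
    q * suc a       ≤⟨ *-monoʳ-≤ q (+-monoˡ-≤ a (≤-trans (s≤s z≤n) d<a)) ⟩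
    q * (a + a)     ≡⟨ e q a ⟩
    2 * q * a       ≤⟨ *-monoˡ-≤ a (≤-trans (m≤n+m _ a₀) a≥) ⟩
    a * a           ∎
    where
    open ≤-Reasoning
    q : ℕ
    q = suc s * (d * d)
    e : ∀ q a → q * (a + a) ≡ 2 * q * a
    e = solve-∀

  upper : ∀ a n → a ≥ a₀ + 2 * (suc s * (d * d)) → d < a → n ≥ N + K →
    (w : Multigraph n) → InF n (suc s) (SigmaT (suc R) d a (suc s)) w → PG w ≤ PiT (suc R) d a n
  upper a n a≥ d<a n≥ w inF = begin
    PG w                          ≡⟨ prodPairs-cong n (λ i<j → sym (symmetrise-< w i<j)) ⟩
    PG w′                          ≡⟨ PG-tabulate w′ id ⟩
    edgeProd w′ (allFin n)         ≤⟨ sharp-bound (allFin n) (subst (N + K ≤_) (sym size-l) n≥) bounded ⟩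
    PiT (suc R) d a (length (allFin n)) ≡⟨ cong (PiT (suc R) d a) size-l ⟩
    PiT (suc R) d a n             ∎
    where
    open ≤-Reasoning
    w′ : Multigraph n
    w′ = symmetrise w
    size-l : length (allFin n) ≡ n
    size-l = length-tabulate id
    open Descent R d s a d<a (large a≥ d<a) w′ (symmetrise-Symm w)
    -- The hypothesis concerns multigraphs on `Fin (length l)`, so `l` is numbered by `lookup`. It
    -- applies unless a finite search finds an `s`-set with too many edges, which is then the set to
    -- delete.
    dichotomy : ∀ l → n₀ ≤ length l → edgeProd w′ l ≤ PiT (suc R) d a (length l) ⊎ Dense l
    dichotomy l n₀≤ with anySubset? (λ X → (∣ X ∣ ≟ s) ×-dec
      (SigmaT (suc R) d a s <? eIn (λ i j → w′ (lookup l i) (lookup l j)) X))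
    ... | yes (X , size , heavy) = inj₂ (dense (select X (lookup l)) (select (∁ X) (lookup l))
      (↭-trans (select-∁-↭ X (lookup l)) (↭-reflexive (tabulate-lookup l)))
      (trans (length-select X _) size) (subst (SigmaT (suc R) d a s <_) (eIn-select w′ (lookup l) X) heavy))
    ... | no none = inj₁ (subst (_≤ _) (trans (PG-tabulate w′ (lookup l)) (cong (edgeProd w′) (tabulate-lookup l)))
      (proj₂ (hyp a (length l) (≤-trans (m≤m+n a₀ _) a≥) d<a n₀≤) _
        (λ X size → ≮⇒≥ (λ heavy → none (X , size , heavy)))))
    open Threshold n₀ 1≤s dichotomy using (sharp-bound)
    bounded : Bounded w′ (suc s) (SigmaT (suc R) d a (suc s)) (allFin n)
    bounded ys zs σ len with select-↭ id ys zs σ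
    ... | X , τ = begin
      edgeSum w′ ys             ≡⟨ edgeSum-↭ (symmetrise-Symm w) τ ⟩
      edgeSum w′ (select X id)  ≡⟨ eIn-select w′ id X ⟨
      eIn w′ X                  ≡⟨ eIn-cong (symmetrise-< w) X ⟩
      eIn w X                  ≤⟨ inF X (trans (sym (length-select X id)) (trans (sym (↭-length τ)) len)) ⟩
      SigmaT (suc R) d a (suc s) ∎
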